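{- Let $G$ be the intersection graph of a family $\mathcal{D}$ of $n$ unit disks in $\mathbb{R}^2$. One can compute, in $O(n\log n)$ time, a tree decomposition $\mathcal{T}=(T,\{X_t\}_{t\in V(T)})$ and a layering $(V_1,V_2,\ldots)$ of $G$ such that $|V(T)|=O(n)$ and $\alpha(G[X_t\cap V_i])\le3$ for every bag $X_t$ and layer $V_i$. In particular, $G$ has layered tree-independence number at most $3$.
   Context: A family of unit disks is a family of closed disks in $\mathbb{R}^2$ with a common radius, given by their centers; its intersection graph has a vertex per disk, two adjacent iff the disks intersect. $\alpha$ denotes independence number. A tree decomposition of $G$ is a pair $(T,\{X_t\})$ with $T$ a tree and bags $X_t\subseteq V(G)$ such that every vertex lies in some bag, every edge has both ends in some bag, and for each vertex the nodes whose bags contain it induce a connected subtree. A layering of $G$ is a partition $(V_1,V_2,\ldots)$ of $V(G)$ such that every edge joins vertices in the same or consecutive layers. The layered tree-independence number of $G$ is the minimum over tree decompositions and layerings of $\max_{t,i}\alpha(G[X_t\cap V_i])$. -}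

module Defs where

open import Algebra.Structures using (IsCommutativeRing)
open import Data.Bool.Base using (Bool; true; false; not; _∧_; if_then_else_)
open import Data.Fin.Base using (Fin; zero; suc; toℕ; fromℕ; inject₁)
open import Data.Fin.Subset using (Subset; _∈_)
open import Data.List.Base using (List; []; _∷_; _++_; _∷ʳ_; length; map; concatMap; allFin)
import Data.List.Membership.Propositional as ListMem
open import Data.Nat.Base using (ℕ; zero; suc; pred; _+_; _*_; _∸_; _≤_; _≡ᵇ_; _≤ᵇ_; ∣_-_∣)
open import Data.Product.Base using (Σ; ∃; ∃-syntax; _×_; _,_; proj₁; proj₂)
open import Data.Sum.Base using (_⊎_; inj₁; inj₂)
open import Function.Base using (_∘_)
open import Function.Bundles using (_⇔_)
open import Function.Definitions using (Injective)
open import Relation.Binary.Construct.Closure.ReflexiveTransitive using (Star)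
open import Relation.Binary.PropositionalEquality using (_≡_; _≢_; refl; ≢-sym)
open import Relation.Binary.Structures using (IsStrictTotalOrder)
open import Relation.Nullary using (¬_; yes; no; does)

------------------------------------------------------------------------
-- Real numbers, axiomatically: a complete ordered field.

record Reals : Set₁ where
  infix  4 _≈_ _<ʳ_ _≤ʳ_
  infixl 6 _+ʳ_ _-ʳ_
  infixl 7 _*ʳ_ _÷ʳ_
  field
    Carrier            : Set
    _≈_ _<ʳ_           : Carrier → Carrier → Set
    _+ʳ_ _*ʳ_          : Carrier → Carrier → Carrier
    -ʳ_                : Carrier → Carrier
    0ʳ 1ʳ              : Carrier
    isCommutativeRing  : IsCommutativeRing _≈_ _+ʳ_ _*ʳ_ -ʳ_ 0ʳ 1ʳ
    isStrictTotalOrder : IsStrictTotalOrder _≈_ _<ʳ_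
    0<1                : 0ʳ <ʳ 1ʳ
    inverse            : ∀ x → ¬ (x ≈ 0ʳ) → ∃[ y ] (x *ʳ y ≈ 1ʳ)
    +-mono-<           : ∀ x y z → x <ʳ y → (x +ʳ z) <ʳ (y +ʳ z)
    *-pos              : ∀ x y → 0ʳ <ʳ x → 0ʳ <ʳ y → 0ʳ <ʳ (x *ʳ y)

  _≤ʳ_ : Carrier → Carrier → Set
  x ≤ʳ y = x <ʳ y ⊎ x ≈ y

  IsUpperBound : (Carrier → Set) → Carrier → Set
  IsUpperBound S u = ∀ x → S x → x ≤ʳ u

  -- "No y < s is an upper bound", in its positive form.
  IsSupremum : (Carrier → Set) → Carrier → Set
  IsSupremum S s = IsUpperBound S s × (∀ y → y <ʳ s → ∃[ x ] (S x × y <ʳ x))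

  field
    complete : (S : Carrier → Set) → ∃ S → ∃ (IsUpperBound S) → ∃ (IsSupremum S)

  open IsStrictTotalOrder isStrictTotalOrder public using (_≟_; _<?_)

  _-ʳ_ : Carrier → Carrier → Carrier
  x -ʳ y = x +ʳ (-ʳ y)

  -- Total division, with x ÷ʳ 0ʳ = 0ʳ.
  _÷ʳ_ : Carrier → Carrier → Carrier
  x ÷ʳ y with y ≟ 0ʳ
  ... | yes _   = 0ʳ
  ... | no  y≉0 = x *ʳ proj₁ (inverse y y≉0)

------------------------------------------------------------------------
-- Maxima, minima and asymptotic bounds

IsMax : (ℕ → Set) → ℕ → Set
IsMax P k = P k × (∀ j → P j → j ≤ k)

IsMin : (ℕ → Set) → ℕ → Set
IsMin P k = P k × (∀ j → P j → k ≤ j)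

infix 4 _∈O_
_∈O_ : (ℕ → ℕ) → (ℕ → ℕ) → Set
f ∈O g = ∃[ C ] ∃[ n₀ ] (∀ n → n₀ ≤ n → f n ≤ C * g n)

------------------------------------------------------------------------
-- Simple graphs

record Graph (V : Set) : Set₁ where
  field
    Adj       : V → V → Set
    symmetric : ∀ {u v} → Adj u v → Adj v u
    loopless  : ∀ {v} → ¬ Adj v v

open Graph public

-- Induced subgraph. It is only used with predicates P whose proofs are unique,
-- so that the elements of Σ V P are the vertices satisfying P.
_[_] : {V : Set} → Graph V → (P : V → Set) → Graph (Σ V P)
G [ P ] = record
  { Adj       = λ u v → Adj G (proj₁ u) (proj₁ v)
  ; symmetric = symmetric G
  ; loopless  = loopless G
  }

HasIndependentSet : {V : Set} → Graph V → ℕ → Set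
HasIndependentSet {V} G k =
  Σ (Fin k → V) λ f → Injective _≡_ _≡_ f × (∀ i j → ¬ Adj G (f i) (f j))

IsIndependenceNumber : {V : Set} → Graph V → ℕ → Set
IsIndependenceNumber G = IsMax (HasIndependentSet G)

α≤ : {V : Set} → Graph V → ℕ → Set
α≤ G b = ∃[ k ] (IsIndependenceNumber G k × k ≤ b)

fromEdges : ∀ {m} → List (Fin m × Fin m) → Graph (Fin m)
fromEdges E = record
  { Adj       = λ s t → s ≢ t × ((s , t) ListMem.∈ E ⊎ (t , s) ListMem.∈ E)
  ; symmetric = λ { (s≢t , inj₁ e) → ≢-sym s≢t , inj₂ e
                  ; (s≢t , inj₂ e) → ≢-sym s≢t , inj₁ e }
  ; loopless  = λ (v≢v , _) → v≢v refl
  }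

Connected : {V : Set} → Graph V → Set
Connected G = ∀ u v → Star (Adj G) u v

record Cycle {V : Set} (G : Graph V) : Set where
  field
    k        : ℕ
    vertex   : Fin (3 + k) → V
    distinct : Injective _≡_ _≡_ vertex
    steps    : ∀ i → Adj G (vertex (inject₁ i)) (vertex (suc i))
    closing  : Adj G (vertex (fromℕ (2 + k))) (vertex zero)

record IsTree {V : Set} (G : Graph V) : Set where
  field
    node      : V
    connected : Connected G
    acyclic   : ¬ Cycle G

------------------------------------------------------------------------
-- Tree decompositions, layerings, layered tree-independence number

record TreeDecomposition {n : ℕ} (G : Graph (Fin n)) : Set where
  field
    size  : ℕ
    edges : List (Fin size × Fin size)
    bag   : Fin size → Subset n

  tree : Graph (Fin size)
  tree = fromEdges edges

  field
    isTree         : IsTree tree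
    coversVertices : ∀ v → ∃[ t ] v ∈ bag t
    coversEdges    : ∀ u v → Adj G u v → ∃[ t ] (u ∈ bag t × v ∈ bag t)
    connectedNodes : ∀ v → Connected (tree [ (λ t → v ∈ bag t) ])

open TreeDecomposition public

-- V_i is the set of vertices v with layer v ≡ i.
record Layering {n : ℕ} (G : Graph (Fin n)) : Set where
  field
    layer       : Fin n → ℕ
    consecutive : ∀ u v → Adj G u v → ∣ layer u - layer v ∣ ≤ 1

open Layering public

-- G[X_t ∩ V_i]
bagLayer : ∀ {n} {G : Graph (Fin n)} (𝒯 : TreeDecomposition G) (L : Layering G) →
           (t : Fin (size 𝒯)) (i : ℕ) → Graph (Σ (Fin n) λ v → v ∈ bag 𝒯 t × layer L v ≡ i)
bagLayer {G = G} 𝒯 L t i = G [ (λ v → v ∈ bag 𝒯 t × layer L v ≡ i) ]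

IsLayeredWidth : ∀ {n} {G : Graph (Fin n)} → TreeDecomposition G → Layering G → ℕ → Set
IsLayeredWidth 𝒯 L = IsMax (λ k → ∃[ t ] ∃[ i ] IsIndependenceNumber (bagLayer 𝒯 L t i) k)

IsLayeredTreeIndependenceNumber : ∀ {n} → Graph (Fin n) → ℕ → Set
IsLayeredTreeIndependenceNumber G =
  IsMin (λ k → Σ (TreeDecomposition G) λ 𝒯 → Σ (Layering G) λ L → IsLayeredWidth 𝒯 L k)

------------------------------------------------------------------------
-- A real RAM with unit-cost operations. Programs are structured and have finitely
-- many registers and unbounded arrays, named by numerals; integers support addition
-- and truncated subtraction; there is no rounding from reals to integers.

data NExp : Set where
  lit       : ℕ → NExp
  reg       : ℕ → NExp
  arr       : ℕ → NExp → NExp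
  _⊕_ _⊖_   : NExp → NExp → NExp

data RExp : Set where
  0ᴿ 1ᴿ                   : RExp
  arrᴿ                    : ℕ → NExp → RExp
  _⊕ᴿ_ _⊖ᴿ_ _⊗ᴿ_ _⊘ᴿ_     : RExp → RExp → RExp

data BExp : Set where
  _≤ᴺ_ : NExp → NExp → BExp
  _≤ᴿ_ : RExp → RExp → BExp
  notᴮ : BExp → BExp
  _∧ᴮ_ : BExp → BExp → BExp

data Program : Set where
  skip       : Program
  setReg     : ℕ → NExp → Program
  setArr     : ℕ → NExp → NExp → Program
  setArrᴿ    : ℕ → NExp → RExp → Program
  print      : NExp → Program
  _⨾_        : Program → Program → Program
  ifThenElse : BExp → Program → Program → Program
  while      : BExp → Program → Program

costᴺ : NExp → ℕ
costᴺ (lit _)   = 1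
costᴺ (reg _)   = 1
costᴺ (arr _ e) = suc (costᴺ e)
costᴺ (e ⊕ f)   = suc (costᴺ e + costᴺ f)
costᴺ (e ⊖ f)   = suc (costᴺ e + costᴺ f)

costᴿ : RExp → ℕ
costᴿ 0ᴿ         = 1
costᴿ 1ᴿ         = 1
costᴿ (arrᴿ _ e) = suc (costᴺ e)
costᴿ (e ⊕ᴿ f)   = suc (costᴿ e + costᴿ f)
costᴿ (e ⊖ᴿ f)   = suc (costᴿ e + costᴿ f)
costᴿ (e ⊗ᴿ f)   = suc (costᴿ e + costᴿ f)
costᴿ (e ⊘ᴿ f)   = suc (costᴿ e + costᴿ f)

costᴮ : BExp → ℕ
costᴮ (e ≤ᴺ f) = suc (costᴺ e + costᴺ f)
costᴮ (e ≤ᴿ f) = suc (costᴿ e + costᴿ f)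
costᴮ (notᴮ b) = suc (costᴮ b)
costᴮ (b ∧ᴮ c) = suc (costᴮ b + costᴮ c)

update : {A : Set} → (ℕ → A) → ℕ → A → ℕ → A
update f i a j = if j ≡ᵇ i then a else f j

pad : {A : Set} {n : ℕ} → A → (Fin n → A) → ℕ → A
pad {n = zero}  d f _       = d
pad {n = suc n} d f zero    = f zero
pad {n = suc n} d f (suc i) = pad d (f ∘ suc) i

module RealRAM (R : Reals) where
  open Reals R

  record State : Set where
    constructor state
    field
      regs    : ℕ → ℕ
      arrays  : ℕ → ℕ → ℕ
      arraysᴿ : ℕ → ℕ → Carrier
      output  : List ℕ

  open State public

  ⟦_⟧ᴺ : NExp → State → ℕ
  ⟦ lit k ⟧ᴺ   σ = k
  ⟦ reg r ⟧ᴺ   σ = regs σ r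
  ⟦ arr a e ⟧ᴺ σ = arrays σ a (⟦ e ⟧ᴺ σ)
  ⟦ e ⊕ f ⟧ᴺ   σ = ⟦ e ⟧ᴺ σ + ⟦ f ⟧ᴺ σ
  ⟦ e ⊖ f ⟧ᴺ   σ = ⟦ e ⟧ᴺ σ ∸ ⟦ f ⟧ᴺ σ

  ⟦_⟧ᴿ : RExp → State → Carrier
  ⟦ 0ᴿ ⟧ᴿ       σ = 0ʳ
  ⟦ 1ᴿ ⟧ᴿ       σ = 1ʳ
  ⟦ arrᴿ a e ⟧ᴿ σ = arraysᴿ σ a (⟦ e ⟧ᴺ σ)
  ⟦ e ⊕ᴿ f ⟧ᴿ   σ = ⟦ e ⟧ᴿ σ +ʳ ⟦ f ⟧ᴿ σ
  ⟦ e ⊖ᴿ f ⟧ᴿ   σ = ⟦ e ⟧ᴿ σ -ʳ ⟦ f ⟧ᴿ σ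
  ⟦ e ⊗ᴿ f ⟧ᴿ   σ = ⟦ e ⟧ᴿ σ *ʳ ⟦ f ⟧ᴿ σ
  ⟦ e ⊘ᴿ f ⟧ᴿ   σ = ⟦ e ⟧ᴿ σ ÷ʳ ⟦ f ⟧ᴿ σ

  ⟦_⟧ᴮ : BExp → State → Bool
  ⟦ e ≤ᴺ f ⟧ᴮ σ = ⟦ e ⟧ᴺ σ ≤ᵇ ⟦ f ⟧ᴺ σ
  ⟦ e ≤ᴿ f ⟧ᴮ σ = not (does (⟦ f ⟧ᴿ σ <? ⟦ e ⟧ᴿ σ))
  ⟦ notᴮ b ⟧ᴮ σ = not (⟦ b ⟧ᴮ σ)
  ⟦ b ∧ᴮ c ⟧ᴮ σ = ⟦ b ⟧ᴮ σ ∧ ⟦ c ⟧ᴮ σ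

  -- Run P σ τ k: started in σ, the program P halts in τ after k steps.
  data Run : Program → State → State → ℕ → Set where
    skip : ∀ {σ} → Run skip σ σ 1
    setReg : ∀ {r e σ} →
      Run (setReg r e) σ
          (record σ { regs = update (regs σ) r (⟦ e ⟧ᴺ σ) })
          (suc (costᴺ e))
    setArr : ∀ {a i e σ} →
      Run (setArr a i e) σ
          (record σ { arrays = update (arrays σ) a (update (arrays σ a) (⟦ i ⟧ᴺ σ) (⟦ e ⟧ᴺ σ)) })
          (suc (costᴺ i + costᴺ e))
    setArrᴿ : ∀ {a i e σ} →
      Run (setArrᴿ a i e) σ
          (record σ { arraysᴿ = update (arraysᴿ σ) a (update (arraysᴿ σ a) (⟦ i ⟧ᴺ σ) (⟦ e ⟧ᴿ σ)) })
          (suc (costᴺ i + costᴿ e))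
    print : ∀ {e σ} →
      Run (print e) σ (record σ { output = output σ ∷ʳ ⟦ e ⟧ᴺ σ }) (suc (costᴺ e))
    seq : ∀ {P Q σ τ υ k l} → Run P σ τ k → Run Q τ υ l → Run (P ⨾ Q) σ υ (k + l)
    if-true : ∀ {b P Q σ τ k} → ⟦ b ⟧ᴮ σ ≡ true → Run P σ τ k →
      Run (ifThenElse b P Q) σ τ (suc (costᴮ b + k))
    if-false : ∀ {b P Q σ τ k} → ⟦ b ⟧ᴮ σ ≡ false → Run Q σ τ k →
      Run (ifThenElse b P Q) σ τ (suc (costᴮ b + k))
    while-true : ∀ {b P σ τ υ k l} → ⟦ b ⟧ᴮ σ ≡ true → Run P σ τ k → Run (while b P) τ υ l →
      Run (while b P) σ υ (suc (costᴮ b + (k + l)))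
    while-false : ∀ {b P σ} → ⟦ b ⟧ᴮ σ ≡ false →
      Run (while b P) σ σ (suc (costᴮ b))

------------------------------------------------------------------------
-- Unit disks

module UnitDisks (R : Reals) where
  open Reals R
  open RealRAM R

  record Family (n : ℕ) : Set where
    field
      radius          : Carrier
      radius-positive : 0ʳ <ʳ radius
      center          : Fin n → Carrier × Carrier

  open Family public

  InDisk : ∀ {n} → Family n → Fin n → Carrier × Carrier → Set
  InDisk D v (x , y) =
    let a = proj₁ (center D v) ; b = proj₂ (center D v) in
    (x -ʳ a) *ʳ (x -ʳ a) +ʳ (y -ʳ b) *ʳ (y -ʳ b) ≤ʳ radius D *ʳ radius D

  intersectionGraph : ∀ {n} → Family n → Graph (Fin n)
  intersectionGraph D = record
    { Adj       = λ u v → u ≢ v × ∃[ p ] (InDisk D u p × InDisk D v p)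
    ; symmetric = λ (u≢v , p , pu , pv) → ≢-sym u≢v , p , pv , pu
    ; loopless  = λ (v≢v , _) → v≢v refl
    }

  -- Register 0 holds n, real arrays 0 and 1 hold the coordinates of the centers, and
  -- real array 2 holds the radius in cell 0; every other cell is zero.
  inputArraysᴿ : ∀ {n} → Family n → ℕ → ℕ → Carrier
  inputArraysᴿ D 0 = pad 0ʳ (proj₁ ∘ center D)
  inputArraysᴿ D 1 = pad 0ʳ (proj₂ ∘ center D)
  inputArraysᴿ D 2 = update (λ _ → 0ʳ) 0 (radius D)
  inputArraysᴿ D _ = λ _ → 0ʳ

  input : ∀ {n} → Family n → State
  input {n} D = state (update (λ _ → 0) 0 n) (λ _ _ → 0) (inputArraysᴿ D) []

------------------------------------------------------------------------
-- Output format

-- The bags may have quadratic total size even when the tree has linearly many nodes,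
-- so a tree decomposition is written down as a rooted tree in which each node stores
-- the difference of its bag with the bag of its parent. Nodes are listed
-- parents first; node 0 is the root, it is its own `parent', and its bag is `added'.
record Description {n} {G : Graph (Fin n)} (𝒯 : TreeDecomposition G) : Set where
  field
    parent        : Fin (size 𝒯) → Fin (size 𝒯)
    removed added : Fin (size 𝒯) → List (Fin n)
    parent-first  : ∀ t → toℕ (parent t) ≤ pred (toℕ t)
    tree-edges    : ∀ s t → Adj (tree 𝒯) s t ⇔ (s ≢ t × (parent s ≡ t ⊎ parent t ≡ s))
    bag-update    : ∀ t v → v ∈ bag 𝒯 t ⇔
                    ((t ≢ parent t × v ∈ bag 𝒯 (parent t) × ¬ (v ListMem.∈ removed t))
                     ⊎ v ListMem.∈ added t)

  block : Fin (size 𝒯) → List ℕ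
  block t = toℕ (parent t)
          ∷ length (removed t) ∷ map toℕ (removed t)
         ++ length (added t) ∷ map toℕ (added t)

serialize : ∀ {n} {G : Graph (Fin n)} (𝒯 : TreeDecomposition G) → Description 𝒯 → Layering G → List ℕ
serialize {n} 𝒯 δ L =
  size 𝒯 ∷ concatMap (Description.block δ) (allFin (size 𝒯)) ++ map (layer L) (allFin n)

-- Started on D, the program P prints 𝒯 and L within k steps.
ComputesWithin : (R : Reals) → ∀ {n} (D : UnitDisks.Family R n) → Program → ℕ →
                 TreeDecomposition (UnitDisks.intersectionGraph R D) →
                 Layering (UnitDisks.intersectionGraph R D) → Set
ComputesWithin R D P k 𝒯 L =
  Σ (Description 𝒯) λ δ → ∃[ τ ] ∃[ steps ]
    (Run P (UnitDisks.input R D) τ steps × steps ≤ k × output τ ≡ serialize 𝒯 δ L)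
  where open RealRAM R

{-# OPTIONS --safe #-}
module Submission where

-- Two disks of radius r meet iff their centers are at distance at most s = 2r. Layers are
-- formed greedily in the order of the y-coordinates, a new one being started when y exceeds
-- the lowest y of the current one by more than s; adjacent disks then lie in equal or
-- consecutive layers. The tree is a path with one node for each disk v in the order of the
-- x-coordinates, whose bag consists of the preceding disks with x-coordinate at least
-- x(v) − s, so successive bags differ by a window of the sorted order.
-- A bag meets a layer in disks whose centers lie in an s × s square. Four points of such a
-- square can be arranged in a cycle that each coordinate traverses monotonically there and
-- back, so the squared lengths of its sides sum to at most 4 s², and one side is at most s.

open import Defs renaming (_⨾_ to infixr 5 _⨾_)
open import Algebra.Bundles using (CommutativeRing)
import Algebra.Properties.AbelianGroup as AbelianGroupProperties
import Algebra.Properties.Ring as RingProperties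
import Algebra.Properties.Semiring.Mult as Mult
import Algebra.Solver.Ring as RingSolver
open import Algebra.Solver.Ring.AlmostCommutativeRing using (fromCommutativeRing; _-Raw-AlmostCommutative⟶_)
open import Data.Bool.Base using (Bool; true; false; not; T; if_then_else_)
open import Data.Bool.Properties using (T-≡)
open import Data.Empty using (⊥; ⊥-elim)
open import Data.Fin.Base using (Fin; zero; suc; toℕ; fromℕ; fromℕ<; inject₁; inject≤)
open import Data.Fin.Properties using (toℕ-injective; toℕ-inject₁; toℕ-fromℕ<; toℕ-fromℕ; toℕ<n; inject≤-injective)
open import Data.Fin.Subset using (Subset; _∈_)
import Data.Integer.Base as ℤ
import Data.Integer.Properties as ℤ
open import Data.List.Base using (List; []; _∷_; _++_; _∷ʳ_; concat; length; map; allFin; tabulate)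
import Data.List.Membership.Propositional as List
open import Data.List.Membership.Propositional.Properties using (∈-map⁺; ∈-map⁻; ∈-allFin)
open import Data.List.Properties using (++-assoc; ++-identityʳ; ∷ʳ-++; map-tabulate; tabulate-cong)
open import Data.List.Relation.Unary.Any using (here; there)
open import Data.Maybe.Base using (Maybe; just; nothing)
open import Data.Nat.Base as ℕ using (ℕ; zero; suc)
open import Data.Nat.Logarithm using (⌊log₂_⌋; ⌊log₂⌋-mono-≤; ⌊log₂[2^n]⌋≡n)
open import Data.Nat.Solver using (module +-*-Solver)
open import Data.Product.Base using (Σ; ∃; ∃-syntax; _×_; _,_; proj₁; proj₂)
open import Data.Sum.Base using (_⊎_; inj₁; inj₂; [_,_]′)
open import Data.Unit.Base using (⊤; tt)
import Data.Vec.Base as Vec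
open import Data.Vec.Properties using (lookup∘tabulate; lookup⇒[]=; []=⇒lookup)
open import Data.Vec.Properties.WithK using ([]=-irrelevant)
open import Function.Base using (_∘_; id)
open import Function.Bundles using (_⇔_; mk⇔; Equivalence)
open import Level using (0ℓ)
open import Relation.Binary.Construct.Closure.ReflexiveTransitive using (Star; ε; _◅_; gmap; reverse)
import Relation.Binary.Construct.StrictToNonStrict as ToNonStrict
open import Relation.Binary.Definitions using (tri<; tri≈; tri>)
open import Relation.Binary.PropositionalEquality as ≡ using (_≡_; _≢_)
import Relation.Binary.Reasoning.Setoid as SetoidReasoning
open import Relation.Binary.Structures using (IsStrictTotalOrder)
open import Relation.Nullary using (¬_; yes; no; does)

-- Strips of a fixed grid would give the layers at once, but the machine cannot round a real to an
-- integer; a greedy sweep over the sorted y-coordinates needs comparisons only. Writing out every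
-- bag could take quadratic time; since a vertex leaves the sliding window of the x-order at most
-- once, the differences have linear total length and the two merge sorts dominate the time. The
-- path also has a root with empty bag, so it has `suc n` nodes and is a tree for `n = 0` too. The
-- exact maxima and minima behind the independence numbers are obtained classically, excluded middle
-- being extracted from the completeness of the reals. The bags are likewise defined by their
-- meaning and not by the run; the printed differences are then shown to describe them. In the
-- geometric core, each coordinate by itself singles out one of the three perfect matchings of four
-- points that goes well with both others. Whichever matchings the two coordinates choose, some two
-- matchings form a 4-cycle that is bounded in both coordinates.

module IntegerCoefficients (R : CommutativeRing 0ℓ 0ℓ) where
  open CommutativeRing R
  open Mult semiring using (×-homo-+; ×1-homo-*) renaming (_×_ to _·_)
  open RingProperties ring using (-‿distribˡ-*; -‿distribʳ-*; -0#≈0#; -‿involutive)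
  open AbelianGroupProperties +-abelianGroup using () renaming (⁻¹-∙-comm to -‿+-comm)
  open SetoidReasoning setoid

  -- Normalising polynomials requires comparing coefficients by computation. Equality in an
  -- axiomatic ring does not compute, so coefficients are integers, interpreted by the unique
  -- homomorphism.
  fromℤ : ℤ.ℤ → Carrier
  fromℤ (ℤ.+ n)      = n · 1#
  fromℤ (ℤ.-[1+ n ]) = - (suc n · 1#)

  fromℤ-neg : ∀ i → fromℤ (ℤ.- i) ≈ - fromℤ i
  fromℤ-neg (ℤ.+ zero)    = sym -0#≈0#
  fromℤ-neg (ℤ.+ (suc n)) = refl
  fromℤ-neg (ℤ.-[1+ n ])  = sym (-‿involutive _)

  fromℤ-⊖ : ∀ m n → fromℤ (m ℤ.⊖ n) ≈ m · 1# + - (n · 1#)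
  fromℤ-⊖ m zero = sym (trans (+-congˡ -0#≈0#) (+-identityʳ _))
  fromℤ-⊖ zero (suc n) = sym (+-identityˡ _)
  fromℤ-⊖ (suc m) (suc n) = begin
    fromℤ (suc m ℤ.⊖ suc n)               ≡⟨ ≡.cong fromℤ (ℤ.[1+m]⊖[1+n]≡m⊖n m n) ⟩
    fromℤ (m ℤ.⊖ n)                       ≈⟨ fromℤ-⊖ m n ⟩
    a + - b                               ≈⟨ +-identityˡ _ ⟨
    0# + (a + - b)                        ≈⟨ +-congʳ (-‿inverseʳ 1#) ⟨
    (1# + - 1#) + (a + - b)               ≈⟨ +-assoc _ _ _ ⟩
    1# + (- 1# + (a + - b))               ≈⟨ +-congˡ (+-assoc _ _ _) ⟨
    1# + ((- 1# + a) + - b)               ≈⟨ +-congˡ (+-congʳ (+-comm _ _)) ⟩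
    1# + ((a + - 1#) + - b)               ≈⟨ +-congˡ (+-assoc _ _ _) ⟩
    1# + (a + (- 1# + - b))               ≈⟨ +-assoc _ _ _ ⟨
    (1# + a) + (- 1# + - b)               ≈⟨ +-congˡ (-‿+-comm 1# b) ⟩
    (1# + a) + - (1# + b)                 ∎
    where
    a = m · 1#
    b = n · 1#

  fromℤ-+ : ∀ i j → fromℤ (i ℤ.+ j) ≈ fromℤ i + fromℤ j
  fromℤ-+ (ℤ.+ m)      (ℤ.+ n)      = ×-homo-+ 1# m n
  fromℤ-+ (ℤ.+ m)      (ℤ.-[1+ n ]) = fromℤ-⊖ m (suc n)
  fromℤ-+ (ℤ.-[1+ m ]) (ℤ.+ n)      = trans (fromℤ-⊖ n (suc m)) (+-comm _ _)
  fromℤ-+ (ℤ.-[1+ m ]) (ℤ.-[1+ n ]) = begin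
    - (suc (suc (m ℕ.+ n)) · 1#)          ≡⟨ ≡.cong (λ k → - (suc k · 1#)) (+-suc m n) ⟨
    - ((suc m ℕ.+ suc n) · 1#)            ≈⟨ -‿cong (×-homo-+ 1# (suc m) (suc n)) ⟩
    - (suc m · 1# + suc n · 1#)           ≈⟨ -‿+-comm _ _ ⟨
    - (suc m · 1#) + - (suc n · 1#)       ∎
    where open import Data.Nat.Properties using (+-suc)

  fromℤ-*⁺ : ∀ m j → fromℤ (ℤ.+ m ℤ.* j) ≈ m · 1# * fromℤ j
  fromℤ-*⁺ m (ℤ.+ n) = trans (reflexive (≡.cong fromℤ (≡.sym (ℤ.pos-* m n)))) (×1-homo-* m n)
  fromℤ-*⁺ m (ℤ.-[1+ n ]) = begin
    fromℤ (ℤ.+ m ℤ.* ℤ.- (ℤ.+ suc n))     ≡⟨ ≡.cong fromℤ (ℤ.neg-distribʳ-* (ℤ.+ m) (ℤ.+ suc n)) ⟨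
    fromℤ (ℤ.- (ℤ.+ m ℤ.* ℤ.+ suc n))     ≈⟨ fromℤ-neg (ℤ.+ m ℤ.* ℤ.+ suc n) ⟩
    - fromℤ (ℤ.+ m ℤ.* ℤ.+ suc n)         ≈⟨ -‿cong (fromℤ-*⁺ m (ℤ.+ suc n)) ⟩
    - (m · 1# * (suc n · 1#))             ≈⟨ -‿distribʳ-* _ _ ⟩
    m · 1# * - (suc n · 1#)               ∎

  fromℤ-* : ∀ i j → fromℤ (i ℤ.* j) ≈ fromℤ i * fromℤ j
  fromℤ-* (ℤ.+ m)      j = fromℤ-*⁺ m j
  fromℤ-* (ℤ.-[1+ m ]) j = begin
    fromℤ (ℤ.- (ℤ.+ suc m) ℤ.* j)         ≡⟨ ≡.cong fromℤ (ℤ.neg-distribˡ-* (ℤ.+ suc m) j) ⟨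
    fromℤ (ℤ.- (ℤ.+ suc m ℤ.* j))         ≈⟨ fromℤ-neg (ℤ.+ suc m ℤ.* j) ⟩
    - fromℤ (ℤ.+ suc m ℤ.* j)             ≈⟨ -‿cong (fromℤ-*⁺ (suc m) j) ⟩
    - (suc m · 1# * fromℤ j)              ≈⟨ -‿distribˡ-* _ _ ⟩
    - (suc m · 1#) * fromℤ j              ∎

  morphism : ℤ.+-*-rawRing -Raw-AlmostCommutative⟶ fromCommutativeRing R
  morphism = record
    { ⟦_⟧    = fromℤ
    ; +-homo = fromℤ-+
    ; *-homo = fromℤ-*
    ; -‿homo = fromℤ-neg
    ; 0-homo = refl
    ; 1-homo = +-identityʳ 1#
    }

  -- Distinct integers may still coincide in a ring of positive characteristic, so the negative case
  -- makes no claim.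
  fromℤ≟ : ∀ i j → Maybe (fromℤ i ≈ fromℤ j)
  fromℤ≟ i j with i ℤ.≟ j
  ... | yes ≡.refl = just refl
  ... | no  _      = nothing

  open RingSolver ℤ.+-*-rawRing (fromCommutativeRing R) morphism fromℤ≟ public
    using (solve; con; _:=_; _:+_; _:*_; _:-_)

-- Ordered fields, excluded middle, and four points in a square.

module OrderedField (R : Reals) where
  open Reals R

  commutativeRing : CommutativeRing 0ℓ 0ℓ
  commutativeRing = record { isCommutativeRing = isCommutativeRing }

  open CommutativeRing commutativeRing
    using (refl; sym; trans; +-cong; +-congˡ; +-congʳ; +-comm; +-identityˡ; +-identityʳ; -‿inverseʳ; *-cong; *-congˡ; *-congʳ; zeroˡ; zeroʳ)
  open IntegerCoefficients commutativeRing
  open IsStrictTotalOrder isStrictTotalOrder using (compare; <-resp-≈; isEquivalence)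
    renaming (trans to <-trans; irrefl to <-irrefl)
  open ToNonStrict _≈_ _<ʳ_ using () renaming (trans to mk-≤-trans; total to mk-total; <-≤-trans to mk-<-≤-trans; ≤-<-trans to mk-≤-<-trans)

  ≤ʳ-trans : ∀ {x y z} → x ≤ʳ y → y ≤ʳ z → x ≤ʳ z
  ≤ʳ-trans = mk-≤-trans isEquivalence <-resp-≈ <-trans

  <-≤ʳ-trans : ∀ {x y z} → x <ʳ y → y ≤ʳ z → x <ʳ z
  <-≤ʳ-trans = mk-<-≤-trans <-trans (proj₁ <-resp-≈)

  ≤-<ʳ-trans : ∀ {x y z} → x ≤ʳ y → y <ʳ z → x <ʳ z
  ≤-<ʳ-trans = mk-≤-<-trans sym <-trans (proj₂ <-resp-≈)

  ≤ʳ-total : ∀ x y → x ≤ʳ y ⊎ y ≤ʳ x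
  ≤ʳ-total = mk-total compare

  ≤ʳ-refl : ∀ {x} → x ≤ʳ x
  ≤ʳ-refl = inj₂ refl

  ≤ʳ⇒≯ : ∀ {x y} → x ≤ʳ y → ¬ (y <ʳ x)
  ≤ʳ⇒≯ x≤y y<x = <-irrefl refl (≤-<ʳ-trans x≤y y<x)

  ≮ʳ⇒≥ : ∀ {x y} → ¬ (y <ʳ x) → x ≤ʳ y
  ≮ʳ⇒≥ {x} {y} y≮x with compare x y
  ... | tri< x<y _ _ = inj₁ x<y
  ... | tri≈ _ x≈y _ = inj₂ x≈y
  ... | tri> _ _ y<x = ⊥-elim (y≮x y<x)

  ≤ʳ-respˡ : ∀ {x y z} → x ≈ y → x ≤ʳ z → y ≤ʳ z
  ≤ʳ-respˡ x≈y = ≤ʳ-trans (inj₂ (sym x≈y))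

  ≤ʳ-respʳ : ∀ {x y z} → y ≈ z → x ≤ʳ y → x ≤ʳ z
  ≤ʳ-respʳ y≈z x≤y = ≤ʳ-trans x≤y (inj₂ y≈z)

  +ʳ-monoˡ-< : ∀ z {x y} → x <ʳ y → x +ʳ z <ʳ y +ʳ z
  +ʳ-monoˡ-< z = +-mono-< _ _ z

  +ʳ-monoˡ-≤ : ∀ z {x y} → x ≤ʳ y → x +ʳ z ≤ʳ y +ʳ z
  +ʳ-monoˡ-≤ z (inj₁ x<y) = inj₁ (+ʳ-monoˡ-< z x<y)
  +ʳ-monoˡ-≤ z (inj₂ x≈y) = inj₂ (+-congʳ x≈y)

  +ʳ-monoʳ-≤ : ∀ z {x y} → x ≤ʳ y → z +ʳ x ≤ʳ z +ʳ y
  +ʳ-monoʳ-≤ z x≤y = ≤ʳ-respˡ (+-comm _ z) (≤ʳ-respʳ (+-comm _ z) (+ʳ-monoˡ-≤ z x≤y))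

  +ʳ-mono-≤ : ∀ {x y z w} → x ≤ʳ y → z ≤ʳ w → x +ʳ z ≤ʳ y +ʳ w
  +ʳ-mono-≤ {y = y} {z = z} x≤y z≤w = ≤ʳ-trans (+ʳ-monoˡ-≤ z x≤y) (+ʳ-monoʳ-≤ y z≤w)

  +ʳ-mono-< : ∀ {x y z w} → x <ʳ y → z <ʳ w → x +ʳ z <ʳ y +ʳ w
  +ʳ-mono-< {y = y} {z = z} x<y z<w = <-≤ʳ-trans (+ʳ-monoˡ-< z x<y) (+ʳ-monoʳ-≤ y (inj₁ z<w))

  +-nonneg : ∀ {x y} → 0ʳ ≤ʳ x → 0ʳ ≤ʳ y → 0ʳ ≤ʳ x +ʳ y
  +-nonneg 0≤x 0≤y = ≤ʳ-respˡ (+-identityˡ 0ʳ) (+ʳ-mono-≤ 0≤x 0≤y)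

  *-nonneg : ∀ {x y} → 0ʳ ≤ʳ x → 0ʳ ≤ʳ y → 0ʳ ≤ʳ x *ʳ y
  *-nonneg (inj₁ 0<x) (inj₁ 0<y) = inj₁ (*-pos _ _ 0<x 0<y)
  *-nonneg (inj₂ 0≈x) _          = inj₂ (sym (trans (*-congʳ (sym 0≈x)) (zeroˡ _)))
  *-nonneg (inj₁ _)   (inj₂ 0≈y) = inj₂ (sym (trans (*-congˡ (sym 0≈y)) (zeroʳ _)))

  ≤⇒0≤- : ∀ {x y} → x ≤ʳ y → 0ʳ ≤ʳ y -ʳ x
  ≤⇒0≤- {x} {y} x≤y = ≤ʳ-respˡ (-‿inverseʳ x) (+ʳ-monoˡ-≤ (-ʳ x) x≤y)

  ≤-fromGap : ∀ {x y d} → 0ʳ ≤ʳ d → y ≈ x +ʳ d → x ≤ʳ y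
  ≤-fromGap {x} 0≤d eq = ≤ʳ-respʳ (sym eq) (≤ʳ-respˡ (+-identityʳ x) (+ʳ-monoʳ-≤ x 0≤d))

  x≤x+d : ∀ {x d} → 0ʳ ≤ʳ d → x ≤ʳ x +ʳ d
  x≤x+d 0≤d = ≤-fromGap 0≤d refl

  sq : Carrier → Carrier
  sq x = x *ʳ x

  sq-nonneg : ∀ x → 0ʳ ≤ʳ sq x
  sq-nonneg x with ≤ʳ-total 0ʳ x
  ... | inj₁ 0≤x = *-nonneg 0≤x 0≤x
  ... | inj₂ x≤0 = ≤ʳ-respʳ (solve 1 (λ x → (con ℤ.0ℤ :- x) :* (con ℤ.0ℤ :- x) := x :* x) refl x)
                     (*-nonneg (≤⇒0≤- x≤0) (≤⇒0≤- x≤0))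

  -- By y² = (y - x)(y + x) + x², with both factors positive.
  sq-mono-< : ∀ {x y} → 0ʳ <ʳ x → x <ʳ y → sq x <ʳ sq y
  sq-mono-< {x} {y} 0<x x<y =
    proj₁ <-resp-≈ eq (proj₂ <-resp-≈ (+-identityˡ _) (+ʳ-monoˡ-< (sq x) (*-pos _ _ 0<y-x 0<y+x)))
    where
    0<y-x : 0ʳ <ʳ y -ʳ x
    0<y-x = proj₂ <-resp-≈ (-‿inverseʳ x) (+ʳ-monoˡ-< (-ʳ x) x<y)
    0<y+x : 0ʳ <ʳ y +ʳ x
    0<y+x = proj₂ <-resp-≈ (+-identityˡ 0ʳ) (+ʳ-mono-< (<-trans 0<x x<y) 0<x)
    eq : (y -ʳ x) *ʳ (y +ʳ x) +ʳ sq x ≈ sq y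
    eq = solve 2 (λ x y → (y :- x) :* (y :+ x) :+ x :* x := y :* y) refl x y

  -- The sign of `x` is left open: if `y` were below `x`, then `x` would be positive as well and the
  -- squares would compare strictly the wrong way.
  sq-cancel-≤ : ∀ {x y} → 0ʳ <ʳ y → sq x ≤ʳ sq y → x ≤ʳ y
  sq-cancel-≤ 0<y x²≤y² = ≮ʳ⇒≥ (λ y<x → ≤ʳ⇒≯ x²≤y² (sq-mono-< 0<y y<x))

  -- Completeness for arbitrary predicates, together with a decidable order, decides
  -- every P: it holds iff the supremum of {0} ∪ {1 | P} is positive.
  excludedMiddle : (P : Set) → P ⊎ ¬ P
  excludedMiddle P with complete S (0ʳ , inj₁ refl) (1ʳ , bound)
    where
    S : Carrier → Set
    S x = x ≈ 0ʳ ⊎ (x ≈ 1ʳ × P)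
    bound : IsUpperBound S 1ʳ
    bound x (inj₁ x≈0)       = ≤ʳ-respˡ (sym x≈0) (inj₁ 0<1)
    bound x (inj₂ (x≈1 , _)) = inj₂ x≈1
  ... | s , upper , least with 0ʳ <? s
  ...   | no 0≮s = inj₂ λ p → 0≮s (<-≤ʳ-trans 0<1 (upper 1ʳ (inj₂ (refl , p))))
  ...   | yes 0<s with least 0ʳ 0<s
  ...     | x , inj₁ x≈0 , 0<x       = ⊥-elim (<-irrefl (sym x≈0) 0<x)
  ...     | x , inj₂ (_ , p) , 0<x = inj₁ p

  -- For four numbers a, b, c, d, the squared differences along the three perfect
  -- matchings of K₄ are P, Q, S, and any two matchings form a 4-cycle.
  module Matchings {I : Set} (s : Carrier) (f : I → Carrier) (near : ∀ i j → f i ≤ʳ f j +ʳ s) where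

    2s² : Carrier
    2s² = sq s +ʳ sq s

    pair : I → I → I → I → Carrier
    pair i j k l = sq (f i -ʳ f j) +ʳ sq (f k -ʳ f l)

    -- `P` is bounded together with each of the other two matchings, because the matching chosen by
    -- the other coordinate is not known in advance. If it is a different one, the two form the
    -- cycle; if it is the same one, either remaining matching completes it.
    Small : Carrier → Carrier → Carrier → Set
    Small P Q S = P +ʳ Q ≤ʳ 2s² × P +ʳ S ≤ʳ 2s²

    OneSmall : Carrier → Carrier → Carrier → Set
    OneSmall P Q S = Small P Q S ⊎ Small Q P S ⊎ Small S P Q

    Claim : I → I → I → I → Set
    Claim i j k l = OneSmall (pair i j k l) (pair i k j l) (pair i l j k)

    small-resp : ∀ {P Q S P′ Q′ S′} → P ≈ P′ → Q ≈ Q′ → S ≈ S′ → Small P Q S → Small P′ Q′ S′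
    small-resp p q s (h₁ , h₂) = ≤ʳ-respˡ (+-cong p q) h₁ , ≤ʳ-respˡ (+-cong p s) h₂

    small-swap : ∀ {P Q S} → Small P Q S → Small P S Q
    small-swap (h₁ , h₂) = h₂ , h₁

    sq-flip : ∀ x y → sq (x -ʳ y) ≈ sq (y -ʳ x)
    sq-flip = solve 2 (λ x y → (x :- y) :* (x :- y) := (y :- x) :* (y :- x)) refl

    -- A permutation of the four indices only permutes the three matchings, so the claim is
    -- symmetric. Adjacent transpositions are enough to reduce it to sorted values.
    swap₁₂ : ∀ {i j k l} → Claim i j k l → Claim j i k l
    swap₁₂ {i} {j} {k} {l} = go
      where
      p : pair i j k l ≈ pair j i k l
      p = +-congʳ (sq-flip _ _)
      q : pair i k j l ≈ pair j l i k
      q = +-comm _ _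
      r : pair i l j k ≈ pair j k i l
      r = +-comm _ _
      go : Claim i j k l → Claim j i k l
      go (inj₁ h)        = inj₁ (small-swap (small-resp p q r h))
      go (inj₂ (inj₁ h)) = inj₂ (inj₂ (small-resp q p r h))
      go (inj₂ (inj₂ h)) = inj₂ (inj₁ (small-resp r p q h))

    swap₂₃ : ∀ {i j k l} → Claim i j k l → Claim i k j l
    swap₂₃ {i} {j} {k} {l} = go
      where
      r : pair i l j k ≈ pair i l k j
      r = +-congˡ (sq-flip _ _)
      go : Claim i j k l → Claim i k j l
      go (inj₁ h)        = inj₂ (inj₁ (small-resp refl refl r h))
      go (inj₂ (inj₁ h)) = inj₁ (small-resp refl refl r h)
      go (inj₂ (inj₂ h)) = inj₂ (inj₂ (small-swap (small-resp r refl refl h)))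

    swap₃₄ : ∀ {i j k l} → Claim i j k l → Claim i j l k
    swap₃₄ {i} {j} {k} {l} = go
      where
      p : pair i j k l ≈ pair i j l k
      p = +-congˡ (sq-flip _ _)
      go : Claim i j k l → Claim i j l k
      go (inj₁ h)        = inj₁ (small-swap (small-resp p refl refl h))
      go (inj₂ (inj₁ h)) = inj₂ (inj₂ (small-resp refl p refl h))
      go (inj₂ (inj₂ h)) = inj₂ (inj₁ (small-resp refl p refl h))

    -- In sorted order the matching {ab, cd} is small: either cycle through it runs
    -- monotonically from the minimum to the maximum and back.
    sorted : ∀ {i j k l} → f i ≤ʳ f j → f j ≤ʳ f k → f k ≤ʳ f l → Claim i j k l
    sorted {i} {j} {k} {l} i≤j j≤k k≤l = inj₁
      -- Let u, v, w be the gaps, p = u + v + w the span and z = a + s - d the slack, nonnegative by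
      -- `near`. Then s = p + z and s² = p² + z(z + 2p), and 2p² exceeds the sum over either cycle
      -- by mixed products of the gaps only.
      ( ≤-fromGap (+-nonneg (+-nonneg zz zz) (+-nonneg (+-nonneg uvw uvw) (+-nonneg wuv wuv)))
          (solve 5 (λ a b c d s →
             let u = b :- a ; v = c :- b ; w = d :- c ; z = a :+ s :- d
                 zz = z :* (z :+ (u :+ v :+ w) :+ (u :+ v :+ w))
                 uvw = u :* (v :+ w) ; wuv = w :* (u :+ v)
             in s :* s :+ s :* s := (((a :- b) :* (a :- b) :+ (c :- d) :* (c :- d)) :+ ((a :- c) :* (a :- c) :+ (b :- d) :* (b :- d)))
                  :+ ((zz :+ zz) :+ ((uvw :+ uvw) :+ (wuv :+ wuv))))
             refl (f i) (f j) (f k) (f l) s)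
      , ≤-fromGap (+-nonneg (+-nonneg zz zz) (+-nonneg mm mm))
          (solve 5 (λ a b c d s →
             let u = b :- a ; v = c :- b ; w = d :- c ; z = a :+ s :- d
                 zz = z :* (z :+ (u :+ v :+ w) :+ (u :+ v :+ w))
                 mm = u :* (v :+ w) :+ v :* w
             in s :* s :+ s :* s := (((a :- b) :* (a :- b) :+ (c :- d) :* (c :- d)) :+ ((a :- d) :* (a :- d) :+ (b :- c) :* (b :- c)))
                  :+ ((zz :+ zz) :+ (mm :+ mm)))
             refl (f i) (f j) (f k) (f l) s) )
      where
      u  = f j -ʳ f i
      v  = f k -ʳ f j
      w  = f l -ʳ f k
      0≤u : 0ʳ ≤ʳ u
      0≤u = ≤⇒0≤- i≤j
      0≤v : 0ʳ ≤ʳ v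
      0≤v = ≤⇒0≤- j≤k
      0≤w : 0ʳ ≤ʳ w
      0≤w = ≤⇒0≤- k≤l
      0≤p = +-nonneg (+-nonneg 0≤u 0≤v) 0≤w
      0≤z : 0ʳ ≤ʳ (f i +ʳ s) -ʳ f l
      0≤z = ≤⇒0≤- (near l i)
      zz  = *-nonneg 0≤z (+-nonneg (+-nonneg 0≤z 0≤p) 0≤p)
      uvw = *-nonneg 0≤u (+-nonneg 0≤v 0≤w)
      wuv = *-nonneg 0≤w (+-nonneg 0≤u 0≤v)
      mm  = +-nonneg uvw (*-nonneg 0≤v 0≤w)

    -- Insertion sort on the values, each exchange being carried over to the claim by a
    -- transposition.
    insert₄ : ∀ {i j k} l → f i ≤ʳ f j → f j ≤ʳ f k → Claim i j k l
    insert₄ {i} {j} {k} l i≤j j≤k with ≤ʳ-total (f k) (f l)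
    ... | inj₁ k≤l = sorted i≤j j≤k k≤l
    ... | inj₂ l≤k with ≤ʳ-total (f j) (f l)
    ...   | inj₁ j≤l = swap₃₄ (sorted i≤j j≤l l≤k)
    ...   | inj₂ l≤j with ≤ʳ-total (f i) (f l)
    ...     | inj₁ i≤l = swap₃₄ (swap₂₃ (sorted i≤l l≤j j≤k))
    ...     | inj₂ l≤i = swap₃₄ (swap₂₃ (swap₁₂ (sorted l≤i i≤j j≤k)))

    insert₃ : ∀ {i j} k l → f i ≤ʳ f j → Claim i j k l
    insert₃ {i} {j} k l i≤j with ≤ʳ-total (f j) (f k)
    ... | inj₁ j≤k = insert₄ l i≤j j≤k
    ... | inj₂ k≤j with ≤ʳ-total (f i) (f k)
    ...   | inj₁ i≤k = swap₂₃ (insert₄ l i≤k k≤j)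
    ...   | inj₂ k≤i = swap₂₃ (swap₁₂ (insert₄ l k≤i i≤j))

    someSmall : ∀ i j k l → Claim i j k l
    someSmall i j k l with ≤ʳ-total (f i) (f j)
    ... | inj₁ i≤j = insert₃ k l i≤j
    ... | inj₂ j≤i = swap₁₂ (insert₃ k l j≤i)

  module FourPoints {I : Set} (s : Carrier) (f g : I → Carrier)
                    (near-f : ∀ i j → f i ≤ʳ f j +ʳ s) (near-g : ∀ i j → g i ≤ʳ g j +ʳ s) where
    module F = Matchings s f near-f
    module G = Matchings s g near-g

    dist² : I → I → Carrier
    dist² i j = sq (f i -ʳ f j) +ʳ sq (g i -ʳ g j)

    -- Four sides longer than `s` have squared lengths summing to more than 4 s²; summed coordinate
    -- by coordinate, the same total is at most 2 s² + 2 s².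
    cycle-short : ∀ i j k l i′ j′ k′ l′ →
      F.pair i j k l +ʳ F.pair i′ j′ k′ l′ ≤ʳ F.2s² → G.pair i j k l +ʳ G.pair i′ j′ k′ l′ ≤ʳ F.2s² →
      sq s <ʳ dist² i j → sq s <ʳ dist² k l → sq s <ʳ dist² i′ j′ → sq s <ʳ dist² k′ l′ → ⊥
    cycle-short i j k l i′ j′ k′ l′ hf hg d₁ d₂ d₃ d₄ =
      ≤ʳ⇒≯ (+ʳ-mono-≤ hf hg)
        (proj₁ <-resp-≈ rearrange (+ʳ-mono-< (+ʳ-mono-< d₁ d₂) (+ʳ-mono-< d₃ d₄)))
      where
      rearrange : (dist² i j +ʳ dist² k l) +ʳ (dist² i′ j′ +ʳ dist² k′ l′) ≈
                  (F.pair i j k l +ʳ F.pair i′ j′ k′ l′) +ʳ (G.pair i j k l +ʳ G.pair i′ j′ k′ l′)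
      rearrange = solve 8 (λ a b c d a′ b′ c′ d′ →
          ((a :+ a′) :+ (b :+ b′)) :+ ((c :+ c′) :+ (d :+ d′)) := ((a :+ b) :+ (c :+ d)) :+ ((a′ :+ b′) :+ (c′ :+ d′)))
        refl (sq (f i -ʳ f j)) (sq (f k -ʳ f l)) (sq (f i′ -ʳ f j′)) (sq (f k′ -ʳ f l′))
             (sq (g i -ʳ g j)) (sq (g k -ʳ g l)) (sq (g i′ -ʳ g j′)) (sq (g k′ -ʳ g l′))

    -- A matching small for f and one small for g together give a 4-cycle of total
    -- squared length at most 4 s².
    notAllFar : ∀ i j k l →
      sq s <ʳ dist² i j → sq s <ʳ dist² k l → sq s <ʳ dist² i k →
      sq s <ʳ dist² j l → sq s <ʳ dist² i l → sq s <ʳ dist² j k → ⊥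
    notAllFar i j k l ij kl ik jl il jk with F.someSmall i j k l | G.someSmall i j k l
    ... | inj₁ (h , _)        | inj₁ (h′ , _)        = cycle-short i j k l i k j l h h′ ij kl ik jl
    ... | inj₁ (h , _)        | inj₂ (inj₁ (h′ , _)) = cycle-short i j k l i k j l h (≤ʳ-respˡ (+-comm _ _) h′) ij kl ik jl
    ... | inj₁ (_ , h)        | inj₂ (inj₂ (h′ , _)) = cycle-short i j k l i l j k h (≤ʳ-respˡ (+-comm _ _) h′) ij kl il jk
    ... | inj₂ (inj₁ (h , _)) | inj₁ (h′ , _)        = cycle-short i k j l i j k l h (≤ʳ-respˡ (+-comm _ _) h′) ik jl ij kl
    ... | inj₂ (inj₁ (h , _)) | inj₂ (inj₁ (h′ , _)) = cycle-short i k j l i j k l h h′ ik jl ij kl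
    ... | inj₂ (inj₁ (_ , h)) | inj₂ (inj₂ (_ , h′)) = cycle-short i k j l i l j k h (≤ʳ-respˡ (+-comm _ _) h′) ik jl il jk
    ... | inj₂ (inj₂ (h , _)) | inj₁ (_ , h′)        = cycle-short i l j k i j k l h (≤ʳ-respˡ (+-comm _ _) h′) il jk ij kl
    ... | inj₂ (inj₂ (_ , h)) | inj₂ (inj₁ (_ , h′)) = cycle-short i l j k i k j l h (≤ʳ-respˡ (+-comm _ _) h′) il jk ik jl
    ... | inj₂ (inj₂ (h , _)) | inj₂ (inj₂ (h′ , _)) = cycle-short i l j k i j k l h h′ il jk ij kl

-- Intersection of disks in terms of their centers.

module DiskGeometry (R : Reals) where
  open Reals R
  open OrderedField R
  open UnitDisks R
  open CommutativeRing commutativeRing using (refl; sym; trans; +-cong; +-congʳ; +-comm; *-cong; *-congʳ; *-identityˡ)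
  open IntegerCoefficients commutativeRing
  open IsStrictTotalOrder isStrictTotalOrder using () renaming (irrefl to <-irrefl)

  module _ {n : ℕ} (D : Family n) where

    xs ys : Fin n → Carrier
    xs v = proj₁ (center D v)
    ys v = proj₂ (center D v)

    diameter : Carrier
    diameter = radius D +ʳ radius D

    near-coordinate : ∀ {a b p q₁ q₂} → sq (p -ʳ a) +ʳ q₁ ≤ʳ sq (radius D) → 0ʳ ≤ʳ q₁ →
                      sq (p -ʳ b) +ʳ q₂ ≤ʳ sq (radius D) → 0ʳ ≤ʳ q₂ → a ≤ʳ b +ʳ diameter
    near-coordinate {a} {b} {p} ha 0≤q₁ hb 0≤q₂ =
      ≤ʳ-respˡ (solve 3 (λ a b p → ((a :- p) :+ (p :- b)) :+ b := a) refl a b p)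
        (≤ʳ-respʳ (+-comm _ b) (+ʳ-monoˡ-≤ b (+ʳ-mono-≤ a-p≤r p-b≤r)))
      where
      drop : ∀ {c q} → sq (p -ʳ c) +ʳ q ≤ʳ sq (radius D) → 0ʳ ≤ʳ q → sq (p -ʳ c) ≤ʳ sq (radius D)
      drop h 0≤q = ≤ʳ-trans (x≤x+d 0≤q) h
      a-p≤r : a -ʳ p ≤ʳ radius D
      a-p≤r = sq-cancel-≤ (radius-positive D)
        (≤ʳ-respˡ (solve 2 (λ a p → (p :- a) :* (p :- a) := (a :- p) :* (a :- p)) refl a p) (drop ha 0≤q₁))
      p-b≤r : p -ʳ b ≤ʳ radius D
      p-b≤r = sq-cancel-≤ (radius-positive D) (drop hb 0≤q₂)

    adjacent⇒near-x : ∀ u v → Adj (intersectionGraph D) u v → xs u ≤ʳ xs v +ʳ diameter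
    adjacent⇒near-x u v (_ , p , hu , hv) = near-coordinate hu (sq-nonneg _) hv (sq-nonneg _)

    adjacent⇒near-y : ∀ u v → Adj (intersectionGraph D) u v → ys u ≤ʳ ys v +ʳ diameter
    adjacent⇒near-y u v (_ , p , hu , hv) =
      near-coordinate (≤ʳ-respˡ (+-comm _ _) hu) (sq-nonneg _) (≤ʳ-respˡ (+-comm _ _) hv) (sq-nonneg _)

    2≉0 : ¬ (1ʳ +ʳ 1ʳ ≈ 0ʳ)
    2≉0 2≈0 = <-irrefl (sym 2≈0) (<-≤ʳ-trans 0<1 (x≤x+d (inj₁ 0<1)))

    ½ : Carrier
    ½ = proj₁ (inverse (1ʳ +ʳ 1ʳ) 2≉0)

    double-½ : ∀ x → ½ *ʳ x +ʳ ½ *ʳ x ≈ x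
    double-½ x =
      -- A factor `1ʳ` is inserted and handed to the solver as a variable `o`, so that the product
      -- appears in the form `(1ʳ +ʳ 1ʳ) *ʳ ½` of the inverse law.
      trans (+-cong (sym (*-identityˡ _)) (sym (*-identityˡ _)))
      (trans (solve 3 (λ h o x → o :* (h :* x) :+ o :* (h :* x) := ((o :+ o) :* h) :* x) refl ½ 1ʳ x)
      (trans (*-congʳ (proj₂ (inverse (1ʳ +ʳ 1ʳ) 2≉0))) (*-identityˡ x)))

    halve-≤ : ∀ {x y} → x +ʳ x ≤ʳ y +ʳ y → x ≤ʳ y
    halve-≤ h = ≮ʳ⇒≥ λ y<x → ≤ʳ⇒≯ h (+ʳ-mono-< y<x y<x)

    -- The factor 4 stays on the left as a repeated sum, to be cancelled by halving twice in
    -- `in-disk`. The hypothesis `end` holds for both ends, `e = a` and `e = b`.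
    midpoint : ∀ a b e → sq ((a +ʳ b) -ʳ (e +ʳ e)) ≈ sq (a -ʳ b) →
               let q = sq (½ *ʳ (a +ʳ b) -ʳ e) in (q +ʳ q) +ʳ (q +ʳ q) ≈ sq (a -ʳ b)
    midpoint a b e end = trans
      (solve 2 (λ m e → let q = (m :- e) :* (m :- e) in
                 (q :+ q) :+ (q :+ q) := (m :+ m :- (e :+ e)) :* (m :+ m :- (e :+ e))) refl (½ *ʳ (a +ʳ b)) e)
      (trans (*-cong double double) end)
      where
      double = +-congʳ (double-½ (a +ʳ b))

    midpointˡ : ∀ a b → let q = sq (½ *ʳ (a +ʳ b) -ʳ a) in (q +ʳ q) +ʳ (q +ʳ q) ≈ sq (a -ʳ b)
    midpointˡ a b = midpoint a b a
      (solve 2 (λ a b → (a :+ b :- (a :+ a)) :* (a :+ b :- (a :+ a)) := (a :- b) :* (a :- b)) refl a b)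

    midpointʳ : ∀ a b → let q = sq (½ *ʳ (a +ʳ b) -ʳ b) in (q +ʳ q) +ʳ (q +ʳ q) ≈ sq (a -ʳ b)
    midpointʳ a b = midpoint a b b
      (solve 2 (λ a b → (a :+ b :- (b :+ b)) :* (a :+ b :- (b :+ b)) := (a :- b) :* (a :- b)) refl a b)

    in-disk : ∀ {q₁ q₂ d₁ d₂} → (q₁ +ʳ q₁) +ʳ (q₁ +ʳ q₁) ≈ d₁ → (q₂ +ʳ q₂) +ʳ (q₂ +ʳ q₂) ≈ d₂ →
              d₁ +ʳ d₂ ≤ʳ sq diameter → q₁ +ʳ q₂ ≤ʳ sq (radius D)
    in-disk {q₁} {q₂} e₁ e₂ h = halve-≤ (halve-≤
      (≤ʳ-respˡ (trans (+-cong (sym e₁) (sym e₂))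
        (solve 2 (λ q₁ q₂ → ((q₁ :+ q₁) :+ (q₁ :+ q₁)) :+ ((q₂ :+ q₂) :+ (q₂ :+ q₂))
                         := ((q₁ :+ q₂) :+ (q₁ :+ q₂)) :+ ((q₁ :+ q₂) :+ (q₁ :+ q₂))) refl q₁ q₂))
      (≤ʳ-respʳ (solve 1 (λ r → (r :+ r) :* (r :+ r)
                             := ((r :* r) :+ (r :* r)) :+ ((r :* r) :+ (r :* r))) refl (radius D)) h)))

    -- The midpoint of the two centers lies in both disks.
    close⇒adjacent : ∀ u v → u ≢ v → sq (xs u -ʳ xs v) +ʳ sq (ys u -ʳ ys v) ≤ʳ sq diameter →
                     Adj (intersectionGraph D) u v
    close⇒adjacent u v u≢v h = u≢v , (½ *ʳ (xs u +ʳ xs v) , ½ *ʳ (ys u +ʳ ys v)) ,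
      in-disk (midpointˡ _ _) (midpointˡ _ _) h ,
      in-disk (midpointʳ _ _) (midpointʳ _ _) h

    independent⇒far : ∀ {u v} → u ≢ v → ¬ Adj (intersectionGraph D) u v →
                      sq diameter <ʳ sq (xs u -ʳ xs v) +ʳ sq (ys u -ʳ ys v)
    independent⇒far {u} {v} u≢v ¬adj with sq diameter <? (sq (xs u -ʳ xs v) +ʳ sq (ys u -ʳ ys v))
    ... | yes far = far
    ... | no ¬far = ⊥-elim (¬adj (close⇒adjacent u v u≢v (≮ʳ⇒≥ ¬far)))

-- Timed Hoare logic and sorting on the real RAM

open import Data.Nat.Base hiding (zero; suc)
open import Data.Nat.Properties hiding (_<?_)
open ≡ using (refl; sym; trans; cong; cong₂; subst; subst₂; module ≡-Reasoning)

update-here : {A : Set} (f : ℕ → A) (i : ℕ) (a : A) → update f i a i ≡ a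
update-here f i a rewrite Equivalence.to T-≡ (≡⇒≡ᵇ i i refl) = refl

update-other : {A : Set} (f : ℕ → A) {i j : ℕ} (a : A) → j ≢ i → update f i a j ≡ f j
update-other f {i} {j} a j≢i with j ≡ᵇ i in eq
... | false = refl
... | true  = ⊥-elim (j≢i (≡ᵇ⇒≡ j i (Equivalence.from T-≡ eq)))

-- On numerals the implicit argument reduces to the unit type, so comparisons of concrete budgets
-- are settled by evaluation.
≤-literal : ∀ {m n} → {T (m ≤ᵇ n)} → m ≤ n
≤-literal {m} {n} {t} = ≤ᵇ⇒≤ m n t

≤ᵇ-true : ∀ {m n} → (m ≤ᵇ n) ≡ true → m ≤ n
≤ᵇ-true {m} {n} eq = ≤ᵇ⇒≤ m n (Equivalence.from T-≡ eq)

≤ᵇ-false : ∀ {m n} → (m ≤ᵇ n) ≡ false → n < m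
≤ᵇ-false {m} {n} eq = ≰⇒> λ m≤n → subst T eq (≤⇒≤ᵇ m≤n)

_<ᴺ_ : NExp → NExp → BExp
e <ᴺ f = notᴮ (f ≤ᴺ e)

<⇒test : ∀ {m n} → m < n → not (n ≤ᵇ m) ≡ true
<⇒test {m} {n} m<n with n ≤ᵇ m in eq
... | true  = ⊥-elim (<⇒≱ m<n (≤ᵇ-true eq))
... | false = refl

≥⇒test : ∀ {m n} → n ≤ m → not (n ≤ᵇ m) ≡ false
≥⇒test {m} {n} n≤m with n ≤ᵇ m in eq
... | true  = refl
... | false = ⊥-elim (<⇒≱ (≤ᵇ-false eq) n≤m)

incr : ℕ → Program
incr r = setReg r (lit 1 ⊕ reg r)

module HoareLogic (R : Reals) where
  open RealRAM R

  record Exec (P : Program) (σ : State) (budget : ℕ) (Q : State → Set) : Set where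
    constructor exec
    field
      {final} : State
      {steps} : ℕ
      run     : Run P σ final steps
      within  : steps ≤ budget
      post    : Q final

  open Exec public

  weaken : ∀ {P σ b c Q} → b ≤ c → Exec P σ b Q → Exec P σ c Q
  weaken b≤c (exec r w p) = exec r (≤-trans w b≤c) p

  done : ∀ {P σ τ k Q} → Run P σ τ k → Q τ → Exec P σ k Q
  done r p = exec r ≤-refl p

  infixr 4 _▷_
  -- For a primitive instruction unification determines the next state, which replaces an
  -- intermediate assertion.
  _▷_ : ∀ {P P′ σ τ k b Q} → Run P σ τ k → Exec P′ τ b Q → Exec (P ⨾ P′) σ (k + b) Q
  _▷_ {k = k} r (exec r′ w p) = exec (seq r r′) (+-monoʳ-≤ k w) p

  infixl 3 _then_
  _then_ : ∀ {P P′ σ b c Q Q′} → Exec P σ b Q → (∀ τ → Q τ → Exec P′ τ c Q′) → Exec (P ⨾ P′) σ (b + c) Q′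
  exec r w p then next with next _ p
  ... | exec r′ w′ p′ = exec (seq r r′) (+-mono-≤ w w′) p′

  if-rule : ∀ {b P P′ σ c Q} → (⟦ b ⟧ᴮ σ ≡ true → Exec P σ c Q) → (⟦ b ⟧ᴮ σ ≡ false → Exec P′ σ c Q) →
            Exec (ifThenElse b P P′) σ (suc (costᴮ b + c)) Q
  if-rule {b} {σ = σ} t f with ⟦ b ⟧ᴮ σ in eq
  ... | true  with t refl
  ...   | exec r w p = exec (if-true eq r) (s≤s (+-monoʳ-≤ (costᴮ b) w)) p
  if-rule {b} {σ = σ} t f | false with f refl
  ...   | exec r w p = exec (if-false eq r) (s≤s (+-monoʳ-≤ (costᴮ b) w)) p

  -- I φ σ: the invariant holds in σ and the loop entered in σ is granted φ steps.
  module _ {b P} (I : ℕ → State → Set) (Q : State → Set)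
    (turn : ∀ φ σ → I φ σ →
      (⟦ b ⟧ᴮ σ ≡ false × suc (costᴮ b) ≤ φ × Q σ) ⊎
      (⟦ b ⟧ᴮ σ ≡ true × ∃[ c ] ∃[ φ′ ] (suc (costᴮ b + (c + φ′)) ≤ φ × Exec P σ c (I φ′)))) where

    private
      -- The time budget doubles as termination measure: each turn pays at least for its test, so
      -- what is left of `φ` strictly decreases.
      loop : ∀ fuel φ σ → φ ≤ fuel → I φ σ → Exec (while b P) σ φ Q
      loop fuel φ σ φ≤fuel inv with turn φ σ inv
      ... | inj₁ (eq , c , q) = exec (while-false eq) c q
      loop zero φ σ φ≤0 inv | inj₂ (_ , _ , _ , le , _) with () ← ≤-trans le φ≤0
      loop (suc fuel) φ σ φ≤fuel inv | inj₂ (eq , c , φ′ , le , exec r w p)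
        with loop fuel φ′ _ (≤-pred (≤-trans (s≤s (≤-trans (m≤n+m φ′ c) (m≤n+m (c + φ′) (costᴮ b)))) (≤-trans le φ≤fuel))) p
      ... | exec r′ w′ q = exec (while-true eq r r′) (≤-trans (s≤s (+-monoʳ-≤ (costᴮ b) (+-mono-≤ w w′))) le) q

    while-rule : ∀ φ σ → I φ σ → Exec (while b P) σ φ Q
    while-rule φ σ = loop φ φ σ ≤-refl

  -- For loops with a uniform cost per turn: the index of `I` counts the turns still to come, hence
  -- yields termination and total time together.
  for-rule : ∀ {b P} (I : ℕ → State → Set) (c : ℕ) →
    (∀ σ → I 0 σ → ⟦ b ⟧ᴮ σ ≡ false) →
    (∀ m σ → I (suc m) σ → ⟦ b ⟧ᴮ σ ≡ true × Exec P σ c (I m)) →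
    ∀ m σ → I m σ → Exec (while b P) σ (m * (suc (costᴮ b) + c) + suc (costᴮ b)) (I 0)
  for-rule I c exit turn zero σ inv = exec (while-false (exit σ inv)) ≤-refl inv
  for-rule {b} I c exit turn (suc m) σ inv with turn m σ inv
  ... | eq , exec r w p with for-rule I c exit turn m _ p
  ...   | exec r′ w′ q = exec (while-true eq r r′)
          (≤-trans (s≤s (+-monoʳ-≤ (costᴮ b) (+-mono-≤ w w′)))
            (≤-reflexive (cong suc (trans (sym (+-assoc (costᴮ b) c _)) (sym (+-assoc (costᴮ b + c) _ _)))))) q

-- Merging sorted runs.

module Merging (_≼_ : ℕ → ℕ → Set) (≼-refl : ∀ {u} → u ≼ u) (≼-trans : ∀ {u v w} → u ≼ v → v ≼ w → u ≼ w) where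

  SortedOn : (ℕ → ℕ) → ℕ → ℕ → Set
  SortedOn A a b = ∀ p q → a ≤ p → p ≤ q → q < b → A p ≼ A q

  -- State of a merge from `A` into cells `lo` to `k` of `B`. `Taken` and `Rest` are sets of
  -- positions of `A`; keeping them abstract lets one lemma serve for taking from either run.
  record Filled (n : ℕ) (A B : ℕ → ℕ) (lo k : ℕ) (Taken Rest : ℕ → Set) : Set where
    field
      sorted : SortedOn B lo k
      below  : ∀ q p → lo ≤ q → q < k → Rest p → B q ≼ A p
      range  : ∀ q → lo ≤ q → q < k → B q < n
      covers : ∀ p → Taken p → ∃[ q ] (lo ≤ q × q < k × B q ≡ A p)

  -- The appended element is above everything written, by `below`, and below everything that
  -- remains, by `least`.
  take : ∀ {n A B lo k Taken Rest Taken′ Rest′ a} p₀ → lo ≤ k → a ≡ A p₀ → A p₀ < n →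
         Rest p₀ → (∀ p → Rest′ p → A p₀ ≼ A p) → (∀ p → Rest′ p → Rest p) →
         (∀ p → Taken′ p → Taken p ⊎ p ≡ p₀) →
         Filled n A B lo k Taken Rest → Filled n A (update B k a) lo (suc k) Taken′ Rest′
  take {n} {A} {B} {lo} {k} {Taken} {Rest} {Taken′} {Rest′} p₀ lo≤k refl A<n rest₀ least rest⊆ taken⊆ F = record
    { sorted = sorted′ ; below = below′ ; range = range′ ; covers = covers′ }
    where
    open Filled F
    B′ = update B k (A p₀)
    new : B′ k ≡ A p₀
    new = update-here B k (A p₀)
    old : ∀ {q} → q < k → B′ q ≡ B q
    old q<k = update-other B (A p₀) (<⇒≢ q<k)
    sorted′ : SortedOn B′ lo (suc k)
    sorted′ p q lo≤p p≤q q<sk with m<1+n⇒m<n∨m≡n q<sk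
    ... | inj₁ q<k rewrite old q<k | old (≤-<-trans p≤q q<k) = sorted p q lo≤p p≤q q<k
    ... | inj₂ refl with m≤n⇒m<n∨m≡n p≤q
    ...   | inj₁ p<k rewrite new | old p<k = below p p₀ lo≤p p<k rest₀
    ...   | inj₂ refl = ≼-refl
    below′ : ∀ q p → lo ≤ q → q < suc k → Rest′ p → B′ q ≼ A p
    below′ q p lo≤q q<sk r with m<1+n⇒m<n∨m≡n q<sk
    ... | inj₁ q<k rewrite old q<k = below q p lo≤q q<k (rest⊆ p r)
    ... | inj₂ refl rewrite new = least p r
    range′ : ∀ q → lo ≤ q → q < suc k → B′ q < n
    range′ q lo≤q q<sk with m<1+n⇒m<n∨m≡n q<sk
    ... | inj₁ q<k rewrite old q<k = range q lo≤q q<k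
    ... | inj₂ refl rewrite new = A<n
    covers′ : ∀ p → Taken′ p → ∃[ q ] (lo ≤ q × q < suc k × B′ q ≡ A p)
    covers′ p t with taken⊆ p t
    ... | inj₂ refl = k , lo≤k , ≤-refl , new
    ... | inj₁ t′ with covers p t′
    ...   | q , lo≤q , q<k , eq = q , lo≤q , m<n⇒m<1+n q<k , trans (old q<k) eq

  BlockSorted : ℕ → ℕ → (ℕ → ℕ) → Set
  BlockSorted n w A = ∀ m p q → m * w ≤ p → p ≤ q → q < suc m * w → q < n → A p ≼ A q

-- A map of `n` positions onto `n` vertices is a permutation, so `range` and `covers` together
-- express that the order is a rearrangement.
record SortedEnumeration (R : Reals) (K : ℕ → Reals.Carrier R) (n : ℕ) (A : ℕ → ℕ) : Set where
  open Reals R using (_≤ʳ_)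
  field
    sorted : ∀ p q → p ≤ q → q < n → K (A p) ≤ʳ K (A q)
    range  : ∀ p → p < n → A p < n
    covers : ∀ v → v < n → ∃[ p ] (p < n × A p ≡ v)

clamp : ∀ n x → n ∸ (n ∸ x) ≡ x ⊓ n
clamp n x = trans (cong (_∸ (n ∸ x)) (sym (m⊓n+n∸m≡n x n))) (m+n∸n≡m (x ⊓ n) (n ∸ x))

-- Bottom-up merge sort by the keys in real array κ. Register 0 holds n, 1 the block
-- length w, 2, 3, 4 the bounds lo, mid, hi of the two blocks being merged, 5 and 6 the
-- reading positions i, j in them and 7 the writing position k; array 0 holds the
-- current order of the vertices and array 1 receives the merged blocks.
module MergeSort (R : Reals) (κ : ℕ) where
  open Reals R using (Carrier; _≤ʳ_; _<?_)
  open RealRAM R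
  open HoareLogic R
  open OrderedField R using (≮ʳ⇒≥; ≤ʳ-refl; ≤ʳ-trans)

  key : ℕ → RExp
  key r = arrᴿ κ (arr 0 (reg r))

  takeFrom : ℕ → Program
  takeFrom r = setArr 1 (reg 7) (arr 0 (reg r)) ⨾ incr r

  select : Program
  select = ifThenElse (reg 3 ≤ᴺ reg 5) (takeFrom 6)
          (ifThenElse (reg 4 ≤ᴺ reg 6) (takeFrom 5)
          (ifThenElse (key 5 ≤ᴿ key 6) (takeFrom 5) (takeFrom 6)))

  merge : Program
  merge = while (reg 7 <ᴺ reg 4) (select ⨾ incr 7)

  -- n ⊖ (n ⊖ x) is the minimum of x and n.
  mergeBlock : Program
  mergeBlock = setReg 3 (reg 0 ⊖ (reg 0 ⊖ (reg 2 ⊕ reg 1)))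
             ⨾ setReg 4 (reg 0 ⊖ (reg 0 ⊖ (reg 2 ⊕ (reg 1 ⊕ reg 1))))
             ⨾ setReg 5 (reg 2)
             ⨾ setReg 6 (reg 3)
             ⨾ setReg 7 (reg 2)
             ⨾ merge
             ⨾ setReg 2 ((reg 1 ⊕ reg 1) ⊕ reg 2)

  pass : Program
  pass = setReg 2 (lit 0) ⨾ while (reg 2 <ᴺ reg 0) mergeBlock

  copy : Program
  copy = setReg 7 (lit 0) ⨾ while (reg 7 <ᴺ reg 0) (setArr 0 (reg 7) (arr 1 (reg 7)) ⨾ incr 7)

  enumerate : Program
  enumerate = setReg 7 (lit 0) ⨾ while (reg 7 <ᴺ reg 0) (setArr 0 (reg 7) (reg 7) ⨾ incr 7)

  sort : Program
  sort = enumerate ⨾ setReg 1 (lit 1) ⨾ while (reg 1 <ᴺ reg 0) (pass ⨾ copy ⨾ setReg 1 (reg 1 ⊕ reg 1))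

  module Correctness (n : ℕ) (L : ℕ → ℕ) (X : ℕ → ℕ → Carrier) (out : List ℕ) where

    _≼_ : ℕ → ℕ → Set
    u ≼ v = X κ u ≤ʳ X κ v

    open Merging _≼_ ≤ʳ-refl ≤ʳ-trans public

    -- Array 2 is preserved because the second sort runs when the layers are already stored there.
    Frame : State → Set
    Frame σ = regs σ 0 ≡ n × arrays σ 2 ≡ L × arraysᴿ σ ≡ X × output σ ≡ out

    module _ (w lo mid hi : ℕ) (A B₀ : ℕ → ℕ)
             (lo≤mid : lo ≤ mid) (mid≤hi : mid ≤ hi)
             (sortedˡ : SortedOn A lo mid) (sortedʳ : SortedOn A mid hi) (A<n : ∀ p → p < hi → A p < n) where

      Taken Rest : ℕ → ℕ → ℕ → Set
      Taken i j p = (lo ≤ p × p < i) ⊎ (mid ≤ p × p < j)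
      Rest i j p = (i ≤ p × p < mid) ⊎ (j ≤ p × p < hi)

      MergeFrame : State → Set
      MergeFrame σ = Frame σ × regs σ 1 ≡ w × regs σ 2 ≡ lo × regs σ 3 ≡ mid × regs σ 4 ≡ hi × arrays σ 0 ≡ A

      -- `total` is k - lo = (i - lo) + (j - mid) freed of truncated subtraction. At `k = hi` it
      -- forces both runs to be exhausted.
      record Merged (B : ℕ → ℕ) (i j k : ℕ) : Set where
        field
          lo≤i   : lo ≤ i
          i≤mid  : i ≤ mid
          mid≤j  : mid ≤ j
          j≤hi   : j ≤ hi
          total  : k + mid ≡ i + j
          filled : Filled n A B lo k (Taken i j) (Rest i j)
          kept   : ∀ q → q < lo → B q ≡ B₀ q

        lo≤k : lo ≤ k
        lo≤k = +-cancelʳ-≤ mid lo k (≤-trans (+-mono-≤ lo≤i mid≤j) (≤-reflexive (sym total)))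

        keep : ∀ {a} q → q < lo → update B k a q ≡ B₀ q
        keep q q<lo = trans (update-other B _ (<⇒≢ (<-≤-trans q<lo lo≤k))) (kept q q<lo)

      open Merged

      takeˡ : ∀ {B i j k a} → a ≡ A i → i < mid → (∀ p → j ≤ p → p < hi → A i ≼ A p) →
              Merged B i j k → Merged (update B k a) (suc i) j (suc k)
      takeˡ {B} {i} {j} {k} eq i<mid least M = record
        { lo≤i = m≤n⇒m≤1+n (lo≤i M) ; i≤mid = i<mid ; mid≤j = mid≤j M ; j≤hi = j≤hi M
        ; total = cong suc (total M)
        ; filled = take i (lo≤k M) eq (A<n i (<-≤-trans i<mid mid≤hi)) (inj₁ (≤-refl , i<mid))
            (λ { p (inj₁ (i<p , p<mid)) → sortedˡ i p (lo≤i M) (<⇒≤ i<p) p<mid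
               ; p (inj₂ (j≤p , p<hi))  → least p j≤p p<hi })
            (λ { p (inj₁ (i<p , p<mid)) → inj₁ (<⇒≤ i<p , p<mid) ; p (inj₂ h) → inj₂ h })
            (λ { p (inj₁ (lo≤p , p<si)) → [ (λ p<i → inj₁ (inj₁ (lo≤p , p<i))) , inj₂ ]′ (m<1+n⇒m<n∨m≡n p<si)
               ; p (inj₂ h) → inj₁ (inj₂ h) })
            (filled M)
        ; kept = keep M }

      takeʳ : ∀ {B i j k a} → a ≡ A j → j < hi → (∀ p → i ≤ p → p < mid → A j ≼ A p) →
              Merged B i j k → Merged (update B k a) i (suc j) (suc k)
      takeʳ {B} {i} {j} {k} eq j<hi least M = record
        { lo≤i = lo≤i M ; i≤mid = i≤mid M ; mid≤j = m≤n⇒m≤1+n (mid≤j M) ; j≤hi = j<hi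
        ; total = trans (cong suc (total M)) (sym (+-suc i j))
        ; filled = take j (lo≤k M) eq (A<n j j<hi) (inj₂ (≤-refl , j<hi))
            (λ { p (inj₁ (i≤p , p<mid)) → least p i≤p p<mid
               ; p (inj₂ (j<p , p<hi))  → sortedʳ j p (mid≤j M) (<⇒≤ j<p) p<hi })
            (λ { p (inj₁ h) → inj₁ h ; p (inj₂ (j<p , p<hi)) → inj₂ (<⇒≤ j<p , p<hi) })
            (λ { p (inj₁ h) → inj₁ (inj₁ h)
               ; p (inj₂ (mid≤p , p<sj)) → [ (λ p<j → inj₁ (inj₂ (mid≤p , p<j))) , inj₂ ]′ (m<1+n⇒m<n∨m≡n p<sj) })
            (filled M)
        ; kept = keep M }

      MergeInv : ℕ → State → Set
      MergeInv m σ = MergeFrame σ × regs σ 7 + m ≡ hi × Merged (arrays σ 1) (regs σ 5) (regs σ 6) (regs σ 7)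

      Selected : ℕ → State → Set
      Selected m σ = MergeFrame σ × suc (regs σ 7) + m ≡ hi × Merged (arrays σ 1) (regs σ 5) (regs σ 6) (suc (regs σ 7))

      goˡ : ∀ {m σ} → MergeInv (suc m) σ → regs σ 5 < mid →
            (∀ p → regs σ 6 ≤ p → p < hi → A (regs σ 5) ≼ A p) → Exec (takeFrom 5) σ 8 (Selected m)
      goˡ {m} {σ} (fr , rem , M) i<mid least = setArr ▷ done setReg
        (fr , trans (sym (+-suc (regs σ 7) m)) rem
            , takeˡ (cong (λ A → A (regs σ 5)) (proj₂ (proj₂ (proj₂ (proj₂ (proj₂ fr)))))) i<mid least M)

      goʳ : ∀ {m σ} → MergeInv (suc m) σ → regs σ 6 < hi →
            (∀ p → regs σ 5 ≤ p → p < mid → A (regs σ 6) ≼ A p) → Exec (takeFrom 6) σ 8 (Selected m)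
      goʳ {m} {σ} (fr , rem , M) j<hi least = setArr ▷ done setReg
        (fr , trans (sym (+-suc (regs σ 7) m)) rem
            , takeʳ (cong (λ A → A (regs σ 6)) (proj₂ (proj₂ (proj₂ (proj₂ (proj₂ fr)))))) j<hi least M)

      select-correct : ∀ m σ → MergeInv (suc m) σ → Exec select σ 60 (Selected m)
      select-correct m σ inv@(((_ , _ , Xeq , _) , _ , _ , mideq , hieq , Aeq) , rem , M) = weaken ≤-literal
        (if-rule (λ t → weaken ≤-literal (rightOnly (subst (_≤ i) mideq (≤ᵇ-true t))))
        (λ f → if-rule (λ t → weaken ≤-literal (leftOnly (subst (i <_) mideq (≤ᵇ-false f)) (subst (_≤ j) hieq (≤ᵇ-true t))))
        (λ f′ → if-rule (λ t → both-left (subst (i <_) mideq (≤ᵇ-false f)) t)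
                        (λ t → both-right (subst (j <_) hieq (≤ᵇ-false f′)) t))))
        where
        i = regs σ 5
        j = regs σ 6
        k = regs σ 7
        k<hi : k < hi
        k<hi = subst (k <_) rem (m<m+n k z<s)
        rightOnly : mid ≤ i → Exec (takeFrom 6) σ 8 (Selected m)
        rightOnly mid≤i = goʳ inv j<hi (λ p i≤p p<mid → ⊥-elim (<⇒≱ p<mid (≤-trans mid≤i i≤p)))
          where
          -- With the left run exhausted, `total` gives j ≤ k, and k < hi.
          j<hi : j < hi
          j<hi = ≤-<-trans (+-cancelˡ-≤ mid j k (≤-trans (+-monoˡ-≤ j mid≤i) (≤-reflexive (trans (sym (total M)) (+-comm k mid))))) k<hi
        leftOnly : i < mid → hi ≤ j → Exec (takeFrom 5) σ 8 (Selected m)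
        leftOnly i<mid hi≤j = goˡ inv i<mid (λ p j≤p p<hi → ⊥-elim (<⇒≱ p<hi (≤-trans hi≤j j≤p)))
        test : ⟦ key 5 ≤ᴿ key 6 ⟧ᴮ σ ≡ not (does (X κ (A j) <? X κ (A i)))
        test = cong₂ (λ A X → not (does (X κ (A j) <? X κ (A i)))) Aeq Xeq
        both-left : i < mid → ⟦ key 5 ≤ᴿ key 6 ⟧ᴮ σ ≡ true → Exec (takeFrom 5) σ 8 (Selected m)
        both-left i<mid t with X κ (A j) <? X κ (A i) | trans (sym test) t
        ... | no j≮i | _ = goˡ inv i<mid (λ p j≤p p<hi → ≤ʳ-trans (≮ʳ⇒≥ j≮i) (sortedʳ j p (mid≤j M) j≤p p<hi))
        both-right : j < hi → ⟦ key 5 ≤ᴿ key 6 ⟧ᴮ σ ≡ false → Exec (takeFrom 6) σ 8 (Selected m)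
        both-right j<hi t with X κ (A j) <? X κ (A i) | trans (sym test) t
        ... | yes j<i | _ = goʳ inv j<hi (λ p i≤p p<mid → ≤ʳ-trans (inj₁ j<i) (sortedˡ i p (lo≤i M) i≤p p<mid))

      MergeDone : State → Set
      MergeDone σ = MergeFrame σ × Filled n A (arrays σ 1) lo hi (λ p → lo ≤ p × p < hi) (λ _ → ⊥)
                  × (∀ q → q < lo → arrays σ 1 q ≡ B₀ q)

      merge-correct : ∀ m σ → MergeInv m σ → Exec merge σ (m * 70 + 5) MergeDone
      merge-correct m σ inv = finish (for-rule MergeInv 65 exit turn m σ inv)
        where
        exit : ∀ σ → MergeInv 0 σ → ⟦ reg 7 <ᴺ reg 4 ⟧ᴮ σ ≡ false
        exit σ ((_ , _ , _ , _ , hieq , _) , rem , _) =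
          ≥⇒test (≤-reflexive (trans hieq (trans (sym rem) (+-identityʳ _))))
        turn : ∀ m σ → MergeInv (suc m) σ → ⟦ reg 7 <ᴺ reg 4 ⟧ᴮ σ ≡ true × Exec (select ⨾ incr 7) σ 65 (MergeInv m)
        turn m σ inv@((_ , _ , _ , _ , hieq , _) , rem , _) =
          <⇒test (subst (regs σ 7 <_) (sym hieq) (subst (regs σ 7 <_) rem (m<m+n _ z<s))) ,
          weaken ≤-literal (select-correct m σ inv then λ τ sel → done setReg sel)
        finish : ∀ {b} → Exec merge σ b (MergeInv 0) → Exec merge σ b MergeDone
        finish (exec {τ} r w (fr , rem , M)) = exec r w (fr ,
          record { sorted = λ p q lo≤p p≤q q<hi → F.sorted p q lo≤p p≤q (subst (q <_) (sym k≡hi) q<hi)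
                 ; below = λ _ _ _ _ () ; range = λ q lo≤q q<hi → F.range q lo≤q (subst (q <_) (sym k≡hi) q<hi)
                 ; covers = cov } , kept M)
          where
          module F = Filled (filled M)
          i = regs τ 5
          j = regs τ 6
          k≡hi : regs τ 7 ≡ hi
          k≡hi = trans (sym (+-identityʳ _)) rem
          sum : hi + mid ≡ i + j
          sum = trans (cong (_+ mid) (sym k≡hi)) (total M)
          mid≤i : mid ≤ i
          mid≤i = +-cancelʳ-≤ hi mid i (≤-trans (≤-reflexive (trans (+-comm mid hi) sum)) (+-monoʳ-≤ i (j≤hi M)))
          hi≤j : hi ≤ j
          hi≤j = +-cancelʳ-≤ mid hi j (≤-trans (≤-reflexive (trans sum (+-comm i j))) (+-monoʳ-≤ j (i≤mid M)))
          cov : ∀ p → lo ≤ p × p < hi → ∃[ q ] (lo ≤ q × q < hi × arrays τ 1 q ≡ A p)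
          cov p (lo≤p , p<hi) with F.covers p ([ (λ p<mid → inj₁ (lo≤p , <-≤-trans p<mid mid≤i))
                                              , (λ mid≤p → inj₂ (mid≤p , <-≤-trans p<hi hi≤j)) ]′ (<-≤-connex p mid))
          ... | q , lo≤q , q<k , eq = q , lo≤q , subst (q <_) k≡hi q<k , eq

    InRange : (ℕ → ℕ) → Set
    InRange A = ∀ p → p < n → A p < n

    module _ (w : ℕ) (0<w : 0 < w) (A : ℕ → ℕ) (blocks : BlockSorted n w A) (A<n : InRange A) where

      PassFrame : State → Set
      PassFrame σ = Frame σ × regs σ 1 ≡ w × arrays σ 0 ≡ A

      record Blocks (m : ℕ) (B : ℕ → ℕ) : Set where
        field
          sorted : ∀ m′ p q → m′ < m → m′ * (w + w) ≤ p → p ≤ q → q < suc m′ * (w + w) → q < n → B p ≼ B q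
          range  : ∀ q → q < m * (w + w) → q < n → B q < n
          covers : ∀ p → p < m * (w + w) → p < n → ∃[ q ] (q < m * (w + w) × q < n × B q ≡ A p)

      addBlock : ∀ {m hi B B′} → hi ≡ (suc m * (w + w)) ⊓ n →
                 Filled n A B′ (m * (w + w)) hi (λ p → m * (w + w) ≤ p × p < hi) (λ _ → ⊥) →
                 (∀ q → q < m * (w + w) → B′ q ≡ B q) → Blocks m B → Blocks (suc m) B′
      addBlock {m} {hi} {B} {B′} hieq F kept bs = record { sorted = sorted′ ; range = range′ ; covers = covers′ }
        where
        open Blocks bs
        module F = Filled F
        W = w + w
        below-hi : ∀ {q} → q < suc m * W → q < n → q < hi
        below-hi q<W q<n = subst (_ <_) (sym hieq) (⊓-glb q<W q<n)
        hi≤n : hi ≤ n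
        hi≤n = ≤-trans (≤-reflexive hieq) (m⊓n≤n _ n)
        hi≤W : hi ≤ suc m * W
        hi≤W = ≤-trans (≤-reflexive hieq) (m⊓n≤m _ n)
        sorted′ : ∀ m′ p q → m′ < suc m → m′ * W ≤ p → p ≤ q → q < suc m′ * W → q < n → B′ p ≼ B′ q
        sorted′ m′ p q m′<sm lo≤p p≤q q<W q<n with m<1+n⇒m<n∨m≡n m′<sm
        ... | inj₂ refl = F.sorted p q lo≤p p≤q (below-hi q<W q<n)
        ... | inj₁ m′<m rewrite kept q (<-≤-trans q<W (*-monoˡ-≤ W m′<m))
                              | kept p (≤-<-trans p≤q (<-≤-trans q<W (*-monoˡ-≤ W m′<m))) = sorted m′ p q m′<m lo≤p p≤q q<W q<n
        range′ : ∀ q → q < suc m * W → q < n → B′ q < n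
        range′ q q<W q<n with <-≤-connex q (m * W)
        ... | inj₁ q<lo rewrite kept q q<lo = range q q<lo q<n
        ... | inj₂ lo≤q = F.range q lo≤q (below-hi q<W q<n)
        covers′ : ∀ p → p < suc m * W → p < n → ∃[ q ] (q < suc m * W × q < n × B′ q ≡ A p)
        covers′ p p<W p<n with <-≤-connex p (m * W)
        ... | inj₁ p<lo with covers p p<lo p<n
        ...   | q , q<lo , q<n , eq = q , <-≤-trans q<lo (m≤n+m _ W) , q<n , trans (kept q q<lo) eq
        covers′ p p<W p<n | inj₂ lo≤p with F.covers p (lo≤p , below-hi p<W p<n)
        ...   | q , _ , q<hi , eq = q , <-≤-trans q<hi hi≤W , <-≤-trans q<hi hi≤n , eq

      PassAt : ℕ → State → Set
      PassAt m σ = PassFrame σ × regs σ 2 ≡ m * (w + w) × Blocks m (arrays σ 1)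

      -- The cost is charged to the clamped length of the block, so that the lengths over a whole
      -- pass add up to `n`.
      mergeBlock-correct : ∀ m σ → PassAt m σ → regs σ 2 < n →
        Exec mergeBlock σ ((((suc m * (w + w)) ⊓ n) ∸ m * (w + w)) * 70 + 60) (PassAt (suc m))
      mergeBlock-correct m σ ((fr@(neq , _) , weq , Aeq) , loeq , bs) lo<n =
        weaken cost (setReg ▷ setReg ▷ setReg ▷ setReg ▷ setReg ▷
          (merge-correct w (regs σ 2) mid hi A (arrays σ 1) lo≤mid mid≤hi sortedˡ sortedʳ A<n′ (hi ∸ lo) _
             ((fr , weq , refl , refl , refl , Aeq) , m+[n∸m]≡n lo≤hi ,
              record { lo≤i = ≤-refl ; i≤mid = lo≤mid ; mid≤j = ≤-refl ; j≤hi = mid≤hi ; total = refl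
                     ; filled = record
                         { sorted = λ p q lo≤p p≤q q<lo → ⊥-elim (<⇒≱ q<lo (≤-trans lo≤p p≤q))
                         ; below  = λ q p lo≤q q<lo → ⊥-elim (<⇒≱ q<lo lo≤q)
                         ; range  = λ q lo≤q q<lo → ⊥-elim (<⇒≱ q<lo lo≤q)
                         ; covers = λ { p (inj₁ (a , b)) → ⊥-elim (<⇒≱ b a) ; p (inj₂ (a , b)) → ⊥-elim (<⇒≱ b a) } }
                     ; kept = λ _ _ → refl })
           then λ τ (((fr′ , weq′ , loeq′ , _ , _ , Aeq′)) , F , kept) → done setReg
             ((fr′ , weq′ , Aeq′) , cong₂ _+_ (cong₂ _+_ weq′ weq′) (trans loeq′ loeq) ,
              addBlock hieq (subst (λ lo → Filled n A (arrays τ 1) lo hi (λ p → lo ≤ p × p < hi) (λ _ → ⊥)) loeq F)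
                (λ q q<lo → kept q (subst (q <_) (sym loeq) q<lo)) bs)))
        where
        W   = w + w
        lo  = regs σ 2
        mid = regs σ 0 ∸ (regs σ 0 ∸ (regs σ 2 + regs σ 1))
        hi  = regs σ 0 ∸ (regs σ 0 ∸ (regs σ 2 + (regs σ 1 + regs σ 1)))
        mideq : mid ≡ (lo + w) ⊓ n
        mideq rewrite neq | weq = clamp n (lo + w)
        hieq₀ : hi ≡ (lo + W) ⊓ n
        hieq₀ rewrite neq | weq = clamp n (lo + W)
        hieq : hi ≡ (suc m * W) ⊓ n
        hieq = trans hieq₀ (cong (_⊓ n) (trans (+-comm lo W) (cong (W +_) loeq)))
        lo≤mid : lo ≤ mid
        lo≤mid = ≤-trans (⊓-glb (m≤m+n lo w) (<⇒≤ lo<n)) (≤-reflexive (sym mideq))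
        mid≤hi : mid ≤ hi
        mid≤hi = ≤-trans (≤-reflexive mideq) (≤-trans (⊓-monoˡ-≤ n (+-monoʳ-≤ lo (m≤m+n w w))) (≤-reflexive (sym hieq₀)))
        lo≤hi = ≤-trans lo≤mid mid≤hi
        hi≤n : hi ≤ n
        hi≤n = ≤-trans (≤-reflexive hieq₀) (m⊓n≤n _ n)
        A<n′ : ∀ p → p < hi → A p < n
        A<n′ p p<hi = A<n p (<-≤-trans p<hi hi≤n)
        lo≡ : (m + m) * w ≡ lo
        lo≡ = trans (*-distribʳ-+ w m m) (trans (sym (*-distribˡ-+ m w w)) (sym loeq))
        lo+w≡ : suc (m + m) * w ≡ lo + w
        lo+w≡ = trans (cong (w +_) lo≡) (+-comm w lo)
        sortedˡ : SortedOn A lo mid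
        sortedˡ p q lo≤p p≤q q<mid = blocks (m + m) p q (≤-trans (≤-reflexive lo≡) lo≤p) p≤q
          (<-≤-trans q<mid (≤-trans (≤-reflexive mideq) (≤-trans (m⊓n≤m _ n) (≤-reflexive (sym lo+w≡)))))
          (<-≤-trans q<mid (≤-trans mid≤hi hi≤n))
        sortedʳ : SortedOn A mid hi
        sortedʳ p q mid≤p p≤q q<hi = blocks (suc (m + m)) p q (≤-trans (≤-reflexive lo+w≡) lo+w≤p) p≤q
          (<-≤-trans q<hi (≤-trans (≤-reflexive hieq₀) (≤-trans (m⊓n≤m _ n)
            (≤-reflexive (trans (sym (+-assoc lo w w)) (trans (+-comm _ w) (cong (w +_) (sym lo+w≡)))))))) q<n
          where
          q<n = <-≤-trans q<hi hi≤n
          lo+w≤p : lo + w ≤ p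
          lo+w≤p with <-≤-connex p (lo + w)
          ... | inj₂ h = h
          ... | inj₁ p<lo+w = ⊥-elim (<⇒≱ (subst (p <_) (sym mideq) (⊓-glb p<lo+w (≤-<-trans p≤q q<n))) mid≤p)
        cost : 8 + (10 + (2 + (2 + (2 + (((hi ∸ lo) * 70 + 5) + 6))))) ≤ (((suc m * W) ⊓ n) ∸ m * W) * 70 + 60
        cost = subst (λ d → 8 + (10 + (2 + (2 + (2 + ((d * 70 + 5) + 6))))) ≤ (((suc m * W) ⊓ n) ∸ m * W) * 70 + 60)
          (sym (cong₂ _∸_ hieq loeq))
          (≤-trans (≤-reflexive (trans (cong (24 +_) (+-assoc x 5 6)) (trans (+-comm 24 (x + 11)) (+-assoc x 11 24))))
                   (+-monoʳ-≤ x ≤-literal))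
          where x = (((suc m * W) ⊓ n) ∸ m * W) * 70

      PassDone : State → Set
      PassDone σ = PassFrame σ × BlockSorted n (w + w) (arrays σ 1) × InRange (arrays σ 1)
                 × (∀ p → p < n → ∃[ q ] (q < n × arrays σ 1 q ≡ A p))

      block-length : ∀ {lo W} → 0 < W → lo < n →
        ((W + lo) ⊓ n ∸ lo) + (n ∸ (W + lo)) ≡ n ∸ lo × 0 < (W + lo) ⊓ n ∸ lo
      block-length {lo} {W} 0<W lo<n with ≤-total (W + lo) n
      ... | inj₁ le rewrite m≤n⇒m⊓n≡m le | m+n∸n≡m W lo =
              trans (cong (W +_) (trans (cong (n ∸_) (+-comm W lo)) (sym (∸-+-assoc n lo W))))
                    (m+[n∸m]≡n (m+n≤o⇒m≤o∸n W le)) , 0<W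
      ... | inj₂ ge rewrite m≥n⇒m⊓n≡n ge | m≤n⇒m∸n≡0 ge = +-identityʳ _ , m<n⇒0<n∸m lo<n

      -- A block is nonempty, and the allowance of 200 for one of its elements covers the fixed
      -- overhead: 70 + 60 + 5 = 135.
      block-cost : ∀ h g → 0 < h → 5 + ((h * 70 + 60) + (g * 200 + 5)) ≤ (h + g) * 200 + 5
      block-cost (suc h) g _ = begin
        5 + (((70 + h * 70) + 60) + (g * 200 + 5)) ≡⟨ cong (5 +_) (cong (_+ (g * 200 + 5)) (+-comm (70 + h * 70) 60)) ⟩
        135 + h * 70 + (g * 200 + 5)               ≤⟨ +-monoˡ-≤ (g * 200 + 5) (+-mono-≤ {135} {200} ≤-literal (*-monoʳ-≤ h {70} {200} ≤-literal)) ⟩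
        200 + h * 200 + (g * 200 + 5)              ≡⟨ +-assoc (suc h * 200) (g * 200) 5 ⟨
        (suc h * 200 + g * 200) + 5                ≡⟨ cong (_+ 5) (*-distribʳ-+ 200 (suc h) g) ⟨
        (suc h + g) * 200 + 5                      ∎
        where open ≤-Reasoning

      pass-correct : ∀ σ → PassFrame σ → Exec pass σ (2 + (n * 200 + 5)) PassDone
      pass-correct σ fr = setReg ▷ while-rule Inv PassDone turn (n * 200 + 5) _
        (0 , (fr , refl , record { sorted = λ _ _ _ () ; range = λ _ () ; covers = λ _ () }) , ≤-refl)
        where
        W = w + w
        0<W : 0 < W
        0<W = <-≤-trans 0<w (m≤m+n w w)
        Inv : ℕ → State → Set
        Inv φ σ = ∃[ m ] (PassAt m σ × (n ∸ m * W) * 200 + 5 ≤ φ)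
        turn : ∀ φ σ → Inv φ σ →
          (⟦ reg 2 <ᴺ reg 0 ⟧ᴮ σ ≡ false × 5 ≤ φ × PassDone σ) ⊎
          (⟦ reg 2 <ᴺ reg 0 ⟧ᴮ σ ≡ true × ∃[ c ] ∃[ φ′ ] (5 + (c + φ′) ≤ φ × Exec mergeBlock σ c (Inv φ′)))
        turn φ σ (m , at@(fr@((neq , _) , _) , loeq , bs) , le) with <-≤-connex (regs σ 2) n
        ... | inj₂ n≤lo = inj₁ (≥⇒test (≤-trans (≤-reflexive neq) n≤lo) , ≤-trans (m≤n+m 5 _) le ,
                fr ,
                (λ m′ p q lo≤p p≤q q<W q<n → sorted m′ p q
                   (*-cancelʳ-< W m′ m (≤-<-trans lo≤p (≤-<-trans p≤q (below q<n)))) lo≤p p≤q q<W q<n) ,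
                (λ q q<n → range q (below q<n) q<n) ,
                λ p p<n → let (q , _ , q<n , eq) = covers p (below p<n) p<n in q , q<n , eq)
          where
          open Blocks bs
          below : ∀ {q} → q < n → q < m * W
          below q<n = <-≤-trans q<n (≤-trans n≤lo (≤-reflexive loeq))
        ... | inj₁ lo<n = inj₂ (<⇒test (subst (regs σ 2 <_) (sym neq) lo<n) , _ , (n ∸ suc m * W) * 200 + 5 ,
                ≤-trans (subst (λ d → 5 + ((h * 70 + 60) + (g * 200 + 5)) ≤ d * 200 + 5)
                           (proj₁ len) (block-cost h g (proj₂ len))) le ,
                let e = mergeBlock-correct m σ at lo<n in exec (run e) (within e) (suc m , post e , ≤-refl))
          where
          h = ((suc m * W) ⊓ n) ∸ m * W
          g = n ∸ suc m * W
          len = block-length 0<W (subst (_< n) loeq lo<n)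

    copy-correct : ∀ w B σ → Frame σ × regs σ 1 ≡ w × arrays σ 1 ≡ B →
      Exec copy σ (2 + (n * 20 + 5)) (λ τ → (Frame τ × regs τ 1 ≡ w) × (∀ q → q < n → arrays τ 0 q ≡ B q))
    copy-correct w B σ (fr , weq , Beq) = setReg ▷ finish (for-rule Inv 15 exit turn n _ (fr , weq , Beq , refl , λ _ ()))
      where
      Inv : ℕ → State → Set
      Inv m σ = Frame σ × regs σ 1 ≡ w × arrays σ 1 ≡ B × regs σ 7 + m ≡ n × (∀ q → q < regs σ 7 → arrays σ 0 q ≡ B q)
      exit : ∀ σ → Inv 0 σ → ⟦ reg 7 <ᴺ reg 0 ⟧ᴮ σ ≡ false
      exit σ ((neq , _) , _ , _ , rem , _) = ≥⇒test (≤-reflexive (trans neq (trans (sym rem) (+-identityʳ _))))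
      turn : ∀ m σ → Inv (suc m) σ →
        ⟦ reg 7 <ᴺ reg 0 ⟧ᴮ σ ≡ true × Exec (setArr 0 (reg 7) (arr 1 (reg 7)) ⨾ incr 7) σ 15 (Inv m)
      turn m σ (fr@(neq , _) , weq , Beq , rem , eqs) =
        <⇒test (subst (regs σ 7 <_) (trans rem (sym neq)) (m<m+n _ z<s)) ,
        weaken ≤-literal (setArr ▷ done setReg (fr , weq , Beq , trans (sym (+-suc (regs σ 7) m)) rem , λ q q<sk →
          [ (λ q<k → trans (update-other (arrays σ 0) _ (<⇒≢ q<k)) (eqs q q<k))
          , (λ { refl → trans (update-here (arrays σ 0) (regs σ 7) _) (cong (λ B → B (regs σ 7)) Beq) }) ]′ (m<1+n⇒m<n∨m≡n q<sk)))
      finish : ∀ {P σ b} → Exec P σ b (Inv 0) →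
               Exec P σ b (λ τ → (Frame τ × regs τ 1 ≡ w) × (∀ q → q < n → arrays τ 0 q ≡ B q))
      finish (exec r w′ (fr , weq , _ , rem , eqs)) =
        exec r w′ ((fr , weq) , λ q q<n → eqs q (subst (q <_) (trans (sym rem) (+-identityʳ _)) q<n))

    enumerate-correct : ∀ σ → Frame σ →
      Exec enumerate σ (2 + (n * 20 + 5)) (λ τ → Frame τ × (∀ q → q < n → arrays τ 0 q ≡ q))
    enumerate-correct σ fr = setReg ▷ finish (for-rule Inv 15 exit turn n _ (fr , refl , λ _ ()))
      where
      Inv : ℕ → State → Set
      Inv m σ = Frame σ × regs σ 7 + m ≡ n × (∀ q → q < regs σ 7 → arrays σ 0 q ≡ q)
      exit : ∀ σ → Inv 0 σ → ⟦ reg 7 <ᴺ reg 0 ⟧ᴮ σ ≡ false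
      exit σ ((neq , _) , rem , _) = ≥⇒test (≤-reflexive (trans neq (trans (sym rem) (+-identityʳ _))))
      turn : ∀ m σ → Inv (suc m) σ →
        ⟦ reg 7 <ᴺ reg 0 ⟧ᴮ σ ≡ true × Exec (setArr 0 (reg 7) (reg 7) ⨾ incr 7) σ 15 (Inv m)
      turn m σ (fr@(neq , _) , rem , eqs) =
        <⇒test (subst (regs σ 7 <_) (trans rem (sym neq)) (m<m+n _ z<s)) ,
        weaken ≤-literal (setArr ▷ done setReg (fr , trans (sym (+-suc (regs σ 7) m)) rem , λ q q<sk →
          [ (λ q<k → trans (update-other (arrays σ 0) _ (<⇒≢ q<k)) (eqs q q<k))
          , (λ { refl → update-here (arrays σ 0) (regs σ 7) _ }) ]′ (m<1+n⇒m<n∨m≡n q<sk)))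
      finish : ∀ {P σ b} → Exec P σ b (Inv 0) →
               Exec P σ b (λ τ → Frame τ × (∀ q → q < n → arrays τ 0 q ≡ q))
      finish (exec r w′ (fr , rem , eqs)) =
        exec r w′ (fr , λ q q<n → eqs q (subst (q <_) (trans (sym rem) (+-identityʳ _)) q<n))

    -- The index `f` bounds the rounds still to come: `f` more doublings bring the block length up
    -- to `n`.
    Sorting : ℕ → State → Set
    Sorting f σ = Frame σ × 0 < regs σ 1 × n ≤ regs σ 1 * 2 ^ f × BlockSorted n (regs σ 1) (arrays σ 0)
                × InRange (arrays σ 0) × (∀ v → v < n → ∃[ p ] (p < n × arrays σ 0 p ≡ v))

    doubleBlocks : ∀ f σ → Sorting (suc f) σ →
      Exec (pass ⨾ copy ⨾ setReg 1 (reg 1 ⊕ reg 1)) σ ((2 + (n * 200 + 5)) + ((2 + (n * 20 + 5)) + 4)) (Sorting f)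
    doubleBlocks f σ (fr , 0<w , n≤ , bs , range , covers) =
      pass-correct w 0<w (arrays σ 0) bs range σ (fr , refl , refl) then
      λ τ ((fr , weq , _) , bs , range′ , covers′) → copy-correct w (arrays τ 1) τ (fr , weq , refl) then
      λ υ ((fr , weq) , eqs) → done setReg
        ( fr , <-≤-trans 0<w (≤-trans (≤-reflexive (sym weq)) (m≤m+n _ _))
        , ≤-trans n≤ (≤-reflexive (trans (trans (sym (*-assoc w 2 (2 ^ f)))
            (cong (_* 2 ^ f) (trans (*-comm w 2) (cong (w +_) (+-identityʳ w))))) (cong (λ w → (w + w) * 2 ^ f) (sym weq))))
        , (λ m p q lo≤p p≤q q<W q<n → subst₂ _≼_ (sym (eqs p (≤-<-trans p≤q q<n))) (sym (eqs q q<n))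
            (bs m p q (subst (λ w → m * (w + w) ≤ p) weq lo≤p) p≤q (subst (λ w → q < suc m * (w + w)) weq q<W) q<n))
        , (λ p p<n → subst (_< n) (sym (eqs p p<n)) (range′ p p<n))
        , λ v v<n → let (p , p<n , eq) = covers v v<n ; (q , q<n , eq′) = covers′ p p<n in
            q , q<n , trans (eqs q q<n) (trans eq′ eq))
      where w = regs σ 1

    Sorted : State → Set
    Sorted σ = Frame σ × SortedEnumeration R (X κ) n (arrays σ 0)

    roundCost : ℕ
    roundCost = 5 + ((2 + (n * 200 + 5)) + ((2 + (n * 20 + 5)) + 4))

    sort-correct : ∀ f → n ≤ 2 ^ f → ∀ σ → Frame σ → Exec sort σ ((2 + (n * 20 + 5)) + (2 + (f * roundCost + 5))) Sorted
    sort-correct f n≤2^f σ fr = enumerate-correct σ fr then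
      λ τ (fr , eqs) → setReg ▷ while-rule Inv Sorted turn (f * roundCost + 5) _
        ( f , (fr , z<s , ≤-trans n≤2^f (≤-reflexive (sym (+-identityʳ _)))
            -- A block of length 1 consists of a single position.
            , (λ m p q m≤p p≤q q<sm q<n → ≼-reflexive (cong (arrays τ 0) (≤-antisym p≤q
                 (≤-trans (≤-pred q<sm) m≤p))))
            , (λ p p<n → subst (_< n) (sym (eqs p p<n)) p<n) , λ v v<n → v , v<n , eqs v v<n)
        , ≤-refl)
      where
      ≼-reflexive : ∀ {u v} → u ≡ v → u ≼ v
      ≼-reflexive refl = ≤ʳ-refl
      Inv : ℕ → State → Set
      Inv φ σ = ∃[ f ] (Sorting f σ × f * roundCost + 5 ≤ φ)
      turn : ∀ φ σ → Inv φ σ →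
          (⟦ reg 1 <ᴺ reg 0 ⟧ᴮ σ ≡ false × 5 ≤ φ × Sorted σ) ⊎
          (⟦ reg 1 <ᴺ reg 0 ⟧ᴮ σ ≡ true × ∃[ c ] ∃[ φ′ ] (5 + (c + φ′) ≤ φ ×
            Exec (pass ⨾ copy ⨾ setReg 1 (reg 1 ⊕ reg 1)) σ c (Inv φ′)))
      turn φ σ (f , st@(fr@(neq , _) , 0<w , n≤ , bs , range , covers) , le) with <-≤-connex (regs σ 1) n
      ... | inj₂ n≤w = inj₁ (≥⇒test (≤-trans (≤-reflexive neq) n≤w) , ≤-trans (m≤n+m 5 _) le , fr ,
              record { sorted = λ p q p≤q q<n → bs 0 p q z≤n p≤q (<-≤-trans q<n (≤-trans n≤w (m≤m+n _ 0))) q<n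
                     ; range = range ; covers = covers })
      turn φ σ (zero , (_ , _ , n≤ , _) , _) | inj₁ w<n = ⊥-elim (<⇒≱ w<n (≤-trans n≤ (≤-reflexive (*-identityʳ _))))
      turn φ σ (suc f , st@((neq , _) , _) , le) | inj₁ w<n =
        inj₂ (<⇒test (subst (regs σ 1 <_) (sym neq) w<n) , _ , f * roundCost + 5 ,
              ≤-trans (≤-reflexive (sym (+-assoc roundCost (f * roundCost) 5))) le ,
              let e = doubleBlocks f σ st in exec (run e) (within e) (f , post e , ≤-refl))

segment : {A : Set} → (ℕ → A) → ℕ → ℕ → List A
segment f k zero    = []
segment f k (suc m) = f k ∷ segment f (suc k) m

-- Greedy layering along the y-order.

module GreedyLayers (R : Reals) (Y : ℕ → Reals.Carrier R) (s : Reals.Carrier R) (0<s : Reals._<ʳ_ R (Reals.0ʳ R) s)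
                    (n : ℕ) (A : ℕ → ℕ) (enum : SortedEnumeration R Y n A) where
  open Reals R hiding (_≟_)
  open OrderedField R
  open SortedEnumeration enum

  ≤-shift : ∀ {x} → x ≤ʳ x +ʳ s
  ≤-shift = x≤x+d (inj₁ 0<s)

  Done : ℕ → ℕ → Set
  Done k v = ∃[ p ] (p < k × A p ≡ v)

  -- Where a vertex of layer l lies relative to the base b of the current layer c.
  record Placed (c : ℕ) (b : Carrier) (u l : ℕ) : Set where
    field
      l≤c     : l ≤ c
      current : l ≡ c → b ≤ʳ Y u × Y u ≤ʳ b +ʳ s
      earlier : l < c → Y u <ʳ b
      distant : suc l < c → Y u +ʳ s <ʳ b

  -- The first half bounds the height of a layer, as the square argument requires; the second makes
  -- adjacent vertices lie in equal or consecutive layers.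
  Compatible : ℕ → ℕ → ℕ → ℕ → Set
  Compatible u v l m = (l ≡ m → Y u ≤ʳ Y v +ʳ s) × (suc m < l → Y v +ʳ s <ʳ Y u)

  record Layered (k c : ℕ) (b : Carrier) (lay : ℕ → ℕ) : Set where
    field
      base-low   : ∀ p → k ≤ p → p < n → b ≤ʳ Y (A p)
      placed     : ∀ u → Done k u → Placed c b u (lay u)
      compatible : ∀ u v → Done k u → Done k v → Compatible u v (lay u) (lay v)

  open Placed
  open Layered

  start : ∀ lay → Layered 0 0 (Y (A 0)) lay
  start lay = record
    { base-low = λ p _ p<n → sorted 0 p z≤n p<n ; placed = λ { _ (_ , () , _) } ; compatible = λ { _ _ (_ , () , _) } }

  -- Vertices of the layer just closed reach at most b + s, hence stay below the new base. Those of
  -- earlier layers are below b, so even after a shift by s they are below b + s and thus below the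
  -- new base; this is `distant`.
  newLayer : ∀ {k c b lay} → k < n → b +ʳ s <ʳ Y (A k) → Layered k c b lay → Layered k (suc c) (Y (A k)) lay
  newLayer {k} {c} {b} {lay} k<n b+s<y L = record
    { base-low = λ p k≤p p<n → sorted k p k≤p p<n ; placed = placed′ ; compatible = compatible L }
    where
    y = Y (A k)
    placed′ : ∀ u → Done k u → Placed (suc c) y u (lay u)
    placed′ u d = record
      { l≤c = m≤n⇒m≤1+n (l≤c P)
      ; current = λ eq → ⊥-elim (<⇒≱ (s≤s (l≤c P)) (≤-reflexive (sym eq)))
      ; earlier = λ _ → [ (λ l<c → <-≤ʳ-trans (earlier P l<c) (base-low L k ≤-refl k<n))
                        , (λ l≡c → ≤-<ʳ-trans (proj₂ (current P l≡c)) b+s<y) ]′ (m≤n⇒m<n∨m≡n (l≤c P))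
      ; distant = λ { (s≤s l<c) → ≤-<ʳ-trans (inj₁ (+ʳ-monoˡ-< s (earlier P l<c))) b+s<y } }
      where P = placed L u d

  assign : ∀ {k c b lay v} → k < n → v ≡ A k → Y (A k) ≤ʳ b +ʳ s → Layered k c b lay → Layered (suc k) c b (update lay v c)
  assign {k} {c} {b} {lay} k<n refl y≤ L = record
    { base-low = λ p k<p → base-low L p (<⇒≤ k<p) ; placed = placed′ ; compatible = compatible′ }
    where
    lay′ = update lay (A k) c
    b≤y : b ≤ʳ Y (A k)
    b≤y = base-low L k ≤-refl k<n
    P : Placed c b (A k) c
    P = record { l≤c = ≤-refl ; current = λ _ → b≤y , y≤
               ; earlier = λ c<c → ⊥-elim (<-irrefl refl c<c) ; distant = λ h → ⊥-elim (<⇒≱ h (n≤1+n _)) }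
    data View (u : ℕ) : Set where
      old : Done k u → lay′ u ≡ lay u → View u
      new : u ≡ A k → lay′ u ≡ c → View u
    view : ∀ u → Done (suc k) u → View u
    view u d with u ≟ A k
    ... | yes refl = new refl (update-here lay (A k) c)
    ... | no u≢ with d
    ...   | p , p<sk , eq with m<1+n⇒m<n∨m≡n p<sk
    ...     | inj₁ p<k = old (p , p<k , eq) (update-other lay c u≢)
    ...     | inj₂ refl = ⊥-elim (u≢ (sym eq))
    placed′ : ∀ u → Done (suc k) u → Placed c b u (lay′ u)
    placed′ u d with view u d
    ... | old d′ eq rewrite eq = placed L u d′
    ... | new refl eq rewrite eq = P
    compatible′ : ∀ u v → Done (suc k) u → Done (suc k) v → Compatible u v (lay′ u) (lay′ v)
    compatible′ u v du dv with view u du | view v dv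
    ... | old d eq    | old d′ eq′    rewrite eq | eq′ = compatible L u v d d′
    ... | new refl eq | new refl eq′  rewrite eq = (λ _ → ≤-shift) , λ h → ⊥-elim (<⇒≱ h (n≤1+n _))
    ... | old d eq    | new refl eq′  rewrite eq | eq′ =
            (λ l≡c → ≤ʳ-trans (proj₂ (current (placed L u d) l≡c)) (+ʳ-monoˡ-≤ s b≤y)) ,
            λ h → ⊥-elim (<⇒≱ h (≤-trans (l≤c (placed L u d)) (n≤1+n _)))
    -- The new vertex is at or above the base, so the gap recorded in `distant` for the old one
    -- extends to it.
    ... | new refl eq | old d eq′     rewrite eq | eq′ =
            (λ c≡l → ≤ʳ-trans y≤ (+ʳ-monoˡ-≤ s (proj₁ (current (placed L v d) (sym c≡l))))) ,
            λ h → <-≤ʳ-trans (distant (placed L v d) h) b≤y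

  all-compatible : ∀ {c b lay} → Layered n c b lay → ∀ u v → u < n → v < n → Compatible u v (lay u) (lay v)
  all-compatible L u v u<n v<n = compatible L u v (covers u u<n) (covers v v<n)

-- The sliding window in the x-order.

module Window (R : Reals) (K : ℕ → Reals.Carrier R) (s : Reals.Carrier R) (0<s : Reals._<ʳ_ R (Reals.0ʳ R) s)
              (n : ℕ) (A : ℕ → ℕ) (enum : SortedEnumeration R K n A) where
  open Reals R hiding (_≟_)
  open OrderedField R
  open SortedEnumeration enum using (sorted)

  far : ℕ → ℕ → Bool
  far q k = does ((K (A q) +ʳ s) <? K (A k))

  far-true : ∀ {q k} → far q k ≡ true → K (A q) +ʳ s <ʳ K (A k)
  far-true {q} {k} eq with (K (A q) +ʳ s) <? K (A k)
  ... | yes h = h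

  far-false : ∀ {q k} → far q k ≡ false → K (A k) ≤ʳ K (A q) +ʳ s
  far-false {q} {k} eq with (K (A q) +ʳ s) <? K (A k)
  ... | no h = ≮ʳ⇒≥ h

  -- Position `k` is the sentinel of the search: since s > 0 it stops there at the latest, so the
  -- loop of the program can do without a bounds test.
  far-self : ∀ k → far k k ≡ false
  far-self k with (K (A k) +ʳ s) <? K (A k)
  ... | no _  = refl
  ... | yes h = ⊥-elim (≤ʳ⇒≯ (x≤x+d (inj₁ 0<s)) h)

  advance : ℕ → ℕ → ℕ → ℕ
  advance zero    q k = q
  advance (suc f) q k = if far q k then advance f (suc q) k else q

  -- `first (suc k)` is where the bag of node `suc k` begins, the node whose newest vertex is at
  -- position `k`. Each search resumes where the previous one ended, so all of them together advance
  -- at most `n` times.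
  first : ℕ → ℕ
  first zero    = 0
  first (suc k) = advance (k ∸ first k) (first k) k

  record Advanced (q q′ k : ℕ) : Set where
    field
      q≤q′ : q ≤ q′
      q′≤k : q′ ≤ k
      passed : ∀ r → q ≤ r → r < q′ → far r k ≡ true
      stop : far q′ k ≡ false

  advance-spec : ∀ f q k → q + f ≡ k → Advanced q (advance f q k) k
  advance-spec zero q k eq rewrite trans (sym (+-identityʳ q)) eq = record
    { q≤q′ = ≤-refl ; q′≤k = ≤-refl ; passed = λ r k≤r r<k → ⊥-elim (<⇒≱ r<k k≤r) ; stop = far-self k }
  advance-spec (suc f) q k eq with far q k in test
  ... | false = record { q≤q′ = ≤-refl ; q′≤k = subst (q ≤_) eq (m≤m+n q _)
                       ; passed = λ r q≤r r<q → ⊥-elim (<⇒≱ r<q q≤r) ; stop = test }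
  ... | true = record
    { q≤q′ = <⇒≤ q≤q′ ; q′≤k = q′≤k
    ; passed = λ r q≤r r<q′ → [ (λ q<r → passed r q<r r<q′) , (λ { refl → test }) ]′ (m≤n⇒m<n∨m≡n q≤r)
    ; stop = stop }
    where open Advanced (advance-spec f (suc q) k (trans (sym (+-suc q f)) eq))

  first≤ : ∀ k → first k ≤ k
  first-advanced : ∀ k → Advanced (first k) (first (suc k)) k

  first≤ zero    = z≤n
  first≤ (suc k) = m≤n⇒m≤1+n (Advanced.q′≤k (first-advanced k))
  first-advanced k = advance-spec (k ∸ first k) (first k) k (m+[n∸m]≡n (first≤ k))

  -- What is far to the left of one vertex is far from all later ones, so a dropped position never
  -- returns.
  before-first : ∀ k r → k < n → r < first (suc k) → K (A r) +ʳ s <ʳ K (A k)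
  before-first k r k<n r<f with <-≤-connex r (first k)
  ... | inj₂ f≤r = far-true (Advanced.passed (first-advanced k) r f≤r r<f)
  before-first (suc k) r k<n r<f | inj₁ r<f′ =
    <-≤ʳ-trans (before-first k r (<⇒≤ k<n) r<f′) (sorted k (suc k) (n≤1+n k) k<n)

  from-first : ∀ k r → k < n → r < n → first (suc k) ≤ r → K (A k) ≤ʳ K (A r) +ʳ s
  from-first k r k<n r<n f≤r = ≤ʳ-trans (far-false (Advanced.stop (first-advanced k))) (+ʳ-monoˡ-≤ s (sorted _ r f≤r r<n))

  windowLength : ℕ → ℕ
  windowLength k = first (suc k) ∸ first k

  -- Shifted by one: this is the block of node `suc k`, whose parent is node `k`.
  block : ℕ → List ℕ
  block k = k ∷ windowLength k ∷ segment A (first k) (windowLength k) ++ 1 ∷ A k ∷ []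

-- Register 8 holds the current layer and cell 0 of real array 3 its base; the layers
-- are collected in array 2.
module LayerProgram (R : Reals) where
  open Reals R hiding (_≟_)
  open RealRAM R
  open HoareLogic R
  open OrderedField R using (≮ʳ⇒≥)

  y base diam : RExp
  y    = arrᴿ 1 (arr 0 (reg 7))
  base = arrᴿ 3 (lit 0)
  diam = arrᴿ 2 (lit 0) ⊕ᴿ arrᴿ 2 (lit 0)

  chooseLayer : Program
  chooseLayer = ifThenElse (y ≤ᴿ (base ⊕ᴿ diam)) skip (incr 8 ⨾ setArrᴿ 3 (lit 0) y)

  layers : Program
  layers = setReg 7 (lit 0) ⨾ setReg 8 (lit 0) ⨾ setArrᴿ 3 (lit 0) y
         ⨾ while (reg 7 <ᴺ reg 0) (chooseLayer ⨾ setArr 2 (arr 0 (reg 7)) (reg 8) ⨾ incr 7)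

  module Correctness (n : ℕ) (A : ℕ → ℕ) (X : ℕ → ℕ → Carrier) (out : List ℕ)
                     (0<s : 0ʳ <ʳ X 2 0 +ʳ X 2 0) (enum : SortedEnumeration R (X 1) n A) where
    s = X 2 0 +ʳ X 2 0
    open GreedyLayers R (X 1) s 0<s n A enum

    Frame : State → Set
    Frame σ = regs σ 0 ≡ n × arrays σ 0 ≡ A × arraysᴿ σ 0 ≡ X 0 × arraysᴿ σ 1 ≡ X 1 × arraysᴿ σ 2 ≡ X 2 × output σ ≡ out

    Inv : ℕ → State → Set
    Inv m σ = Frame σ × regs σ 7 + m ≡ n × Layered (regs σ 7) (regs σ 8) (arraysᴿ σ 3 0) (arrays σ 2)

    Chosen : ℕ → State → Set
    Chosen m σ = Frame σ × suc (regs σ 7) + m ≡ n × Layered (regs σ 7) (regs σ 8) (arraysᴿ σ 3 0) (arrays σ 2)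
               × X 1 (A (regs σ 7)) ≤ʳ arraysᴿ σ 3 0 +ʳ s

    chooseLayer-correct : ∀ m σ → Inv (suc m) σ → Exec chooseLayer σ 30 (Chosen m)
    chooseLayer-correct m σ (fr@(_ , Aeq , _ , Yeq , Req , _) , rem , L) = weaken ≤-literal
      (if-rule (λ t → weaken ≤-literal (stay t)) new)
      where
      k = regs σ 7
      b = arraysᴿ σ 3 0
      rem′ : suc k + m ≡ n
      rem′ = trans (sym (+-suc k m)) rem
      k<n : k < n
      k<n = subst (k <_) rem (m<m+n k z<s)
      yeq : arraysᴿ σ 1 (arrays σ 0 k) ≡ X 1 (A k)
      yeq = cong₂ (λ Y A → Y (A k)) Yeq Aeq
      test : ⟦ y ≤ᴿ (base ⊕ᴿ diam) ⟧ᴮ σ ≡ not (does ((b +ʳ s) <? X 1 (A k)))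
      test = cong₂ (λ Z y → not (does ((b +ʳ (Z 0 +ʳ Z 0)) <? y))) Req yeq
      stay : ⟦ y ≤ᴿ (base ⊕ᴿ diam) ⟧ᴮ σ ≡ true → Exec skip σ 1 (Chosen m)
      stay t with (b +ʳ s) <? X 1 (A k) | trans (sym test) t
      ... | no h | _ = done skip (fr , rem′ , L , ≮ʳ⇒≥ h)
      new : ⟦ y ≤ᴿ (base ⊕ᴿ diam) ⟧ᴮ σ ≡ false → Exec (incr 8 ⨾ setArrᴿ 3 (lit 0) y) σ 9 (Chosen m)
      new t with (b +ʳ s) <? X 1 (A k) | trans (sym test) t
      ... | yes h | _ = setReg ▷ done setArrᴿ
        (fr , rem′ , subst (λ y → Layered k (suc (regs σ 8)) y (arrays σ 2)) (sym yeq) (newLayer k<n h L) ,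
         subst (λ y → X 1 (A k) ≤ʳ y +ʳ s) (sym yeq) ≤-shift)

    layers-correct : ∀ σ → Frame σ → Exec layers σ (2 + (2 + (5 + (n * 50 + 5))))
      (λ τ → Frame τ × (∀ u v → u < n → v < n → Compatible u v (arrays τ 2 u) (arrays τ 2 v)))
    layers-correct σ fr@(_ , Aeq , _ , Yeq , _) = setReg ▷ setReg ▷ setArrᴿ ▷
      finish (for-rule Inv 45 exit turn n _
        (fr , refl , subst (λ b → Layered 0 0 b (arrays σ 2)) (sym (cong₂ (λ Y A → Y (A 0)) Yeq Aeq)) (start (arrays σ 2))))
      where
      exit : ∀ σ → Inv 0 σ → ⟦ reg 7 <ᴺ reg 0 ⟧ᴮ σ ≡ false
      exit σ ((neq , _) , rem , _) = ≥⇒test (≤-reflexive (trans neq (trans (sym rem) (+-identityʳ _))))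
      turn : ∀ m σ → Inv (suc m) σ → ⟦ reg 7 <ᴺ reg 0 ⟧ᴮ σ ≡ true ×
             Exec (chooseLayer ⨾ setArr 2 (arr 0 (reg 7)) (reg 8) ⨾ incr 7) σ 45 (Inv m)
      turn m σ inv@((neq , _) , rem , _) =
        <⇒test (subst (regs σ 7 <_) (trans rem (sym neq)) (m<m+n _ z<s)) ,
        weaken ≤-literal (chooseLayer-correct m σ inv then λ τ (fr@(_ , Aeq , _) , rem , L , y≤) →
          setArr ▷ done setReg (fr , rem ,
            assign (subst (regs τ 7 <_) rem (m≤m+n _ m)) (cong (λ A → A (regs τ 7)) Aeq) y≤ L))
      finish : ∀ {P σ b} → Exec P σ b (Inv 0) →
        Exec P σ b (λ τ → Frame τ × (∀ u v → u < n → v < n → Compatible u v (arrays τ 2 u) (arrays τ 2 v)))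
      finish (exec {τ} r w (fr , rem , L)) = exec r w (fr ,
        all-compatible (subst (λ k → Layered k (regs τ 8) (arraysᴿ τ 3 0) (arrays τ 2)) (trans (sym (+-identityʳ _)) rem) L))

-- Register 7 holds the node number k, registers 5 and 6 the first positions of the
-- bags of nodes k and k + 1.
module PrintProgram (R : Reals) where
  open Reals R hiding (_≟_)
  open RealRAM R
  open HoareLogic R
  open LayerProgram R using (diam)

  printRemoved : Program
  printRemoved = while (reg 5 <ᴺ reg 6) (print (arr 0 (reg 5)) ⨾ incr 5)

  findFirst : Program
  findFirst = while (notᴮ (arrᴿ 0 (arr 0 (reg 7)) ≤ᴿ (arrᴿ 0 (arr 0 (reg 6)) ⊕ᴿ diam))) (incr 6)

  printNode : Program
  printNode = print (reg 7) ⨾ setReg 6 (reg 5) ⨾ findFirst ⨾ print (reg 6 ⊖ reg 5) ⨾ printRemoved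
            ⨾ print (lit 1) ⨾ print (arr 0 (reg 7)) ⨾ incr 7

  -- The three zeros are the block of the root: its own parent, nothing removed, nothing added.
  printTree : Program
  printTree = print (lit 1 ⊕ reg 0) ⨾ print (lit 0) ⨾ print (lit 0) ⨾ print (lit 0)
            ⨾ setReg 5 (lit 0) ⨾ setReg 7 (lit 0) ⨾ while (reg 7 <ᴺ reg 0) printNode

  printLayers : Program
  printLayers = setReg 7 (lit 0) ⨾ while (reg 7 <ᴺ reg 0) (print (arr 2 (reg 7)) ⨾ incr 7)

  module Correctness (n : ℕ) (A L : ℕ → ℕ) (X : ℕ → ℕ → Carrier)
                     (0<s : 0ʳ <ʳ X 2 0 +ʳ X 2 0) (enum : SortedEnumeration R (X 0) n A) where
    s = X 2 0 +ʳ X 2 0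
    open Window R (X 0) s 0<s n A enum

    Frame : State → Set
    Frame σ = regs σ 0 ≡ n × arrays σ 0 ≡ A × arrays σ 2 ≡ L × arraysᴿ σ ≡ X

    findFirst-correct : ∀ k σ → Frame σ → regs σ 7 ≡ k → regs σ 5 ≡ first k → regs σ 6 ≡ first k → ∀ o → output σ ≡ o →
      Exec findFirst σ (windowLength k * 19 + 15)
        (λ τ → Frame τ × regs τ 7 ≡ k × regs τ 5 ≡ first k × regs τ 6 ≡ first (suc k) × output τ ≡ o)
    findFirst-correct k σ fr keq peq qeq o oeq =
      finish (for-rule Inv 4 exit turn (windowLength k) σ
        (fr , keq , peq , trans (cong (_+ windowLength k) qeq) (m+[n∸m]≡n q≤q′) , ≤-reflexive (sym qeq) , oeq))
      where
      open Advanced (first-advanced k)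
      b = notᴮ (arrᴿ 0 (arr 0 (reg 7)) ≤ᴿ (arrᴿ 0 (arr 0 (reg 6)) ⊕ᴿ diam))
      Inv : ℕ → State → Set
      Inv m σ = Frame σ × regs σ 7 ≡ k × regs σ 5 ≡ first k × regs σ 6 + m ≡ first (suc k) × first k ≤ regs σ 6 × output σ ≡ o
      test : ∀ σ → Frame σ → regs σ 7 ≡ k → ⟦ b ⟧ᴮ σ ≡ not (not (far (regs σ 6) k))
      test σ (_ , Aeq , _ , Xeq) keq rewrite Aeq | Xeq | keq = refl
      exit : ∀ σ → Inv 0 σ → ⟦ b ⟧ᴮ σ ≡ false
      exit σ (fr , keq , _ , rem , _) = trans (test σ fr keq)
        (cong (λ t → not (not t)) (trans (cong (λ q → far q k) (trans (sym (+-identityʳ _)) rem)) stop))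
      turn : ∀ m σ → Inv (suc m) σ → ⟦ b ⟧ᴮ σ ≡ true × Exec (incr 6) σ 4 (Inv m)
      turn m σ (fr , keq , peq , rem , ge , oeq) =
        trans (test σ fr keq) (cong (λ t → not (not t)) (passed (regs σ 6) ge (subst (regs σ 6 <_) rem (m<m+n _ z<s)))) ,
        done setReg (fr , keq , peq , trans (sym (+-suc _ m)) rem , m≤n⇒m≤1+n ge , oeq)
      finish : ∀ {P σ b} → Exec P σ b (Inv 0) →
        Exec P σ b (λ τ → Frame τ × regs τ 7 ≡ k × regs τ 5 ≡ first k × regs τ 6 ≡ first (suc k) × output τ ≡ o)
      finish (exec r w (fr , keq , peq , rem , _ , oeq)) =
        exec r w (fr , keq , peq , trans (sym (+-identityʳ _)) rem , oeq)

    printRemoved-correct : ∀ k p q m σ → Frame σ → regs σ 7 ≡ k → regs σ 5 ≡ p → regs σ 6 ≡ q → p + m ≡ q → ∀ o → output σ ≡ o →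
      Exec printRemoved σ (m * 12 + 5)
        (λ τ → Frame τ × regs τ 7 ≡ k × regs τ 5 ≡ q × output τ ≡ o ++ segment A p m)
    printRemoved-correct k p q m σ fr keq peq qeq sum o oeq =
      finish (for-rule Inv 7 exit turn m σ
        (fr , keq , qeq , trans (cong (_+ m) peq) sum , cong₂ (λ o p → o ++ segment A p m) oeq peq))
      where
      -- The output so far followed by what is still due stays constant, so at the exit it is the
      -- whole list.
      Inv : ℕ → State → Set
      Inv m′ σ = Frame σ × regs σ 7 ≡ k × regs σ 6 ≡ q × regs σ 5 + m′ ≡ q × output σ ++ segment A (regs σ 5) m′ ≡ o ++ segment A p m
      exit : ∀ σ → Inv 0 σ → ⟦ reg 5 <ᴺ reg 6 ⟧ᴮ σ ≡ false
      exit σ (_ , _ , qeq , rem , _) = ≥⇒test (≤-reflexive (trans qeq (trans (sym rem) (+-identityʳ _))))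
      turn : ∀ m σ → Inv (suc m) σ → ⟦ reg 5 <ᴺ reg 6 ⟧ᴮ σ ≡ true ×
             Exec (print (arr 0 (reg 5)) ⨾ incr 5) σ 7 (Inv m)
      turn m σ (fr@(_ , Aeq , _) , keq , qeq , rem , oeq) =
        <⇒test (subst (regs σ 5 <_) (trans rem (sym qeq)) (m<m+n _ z<s)) ,
        (print ▷ done setReg (fr , keq , qeq , trans (sym (+-suc _ m)) rem ,
          trans (∷ʳ-++ (output σ) _ _) (trans (cong (λ a → output σ ++ a ∷ segment A (suc (regs σ 5)) m) (cong (λ A → A (regs σ 5)) Aeq)) oeq)))
      finish : ∀ {P σ b} → Exec P σ b (Inv 0) →
        Exec P σ b (λ τ → Frame τ × regs τ 7 ≡ k × regs τ 5 ≡ q × output τ ≡ o ++ segment A p m)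
      finish (exec r w (fr , keq , qeq , rem , oeq)) =
        exec r w (fr , keq , trans (sym (+-identityʳ _)) rem , trans (sym (++-identityʳ _)) oeq)

    AtNode : ℕ → List ℕ → State → Set
    AtNode k o σ = Frame σ × regs σ 7 ≡ k × regs σ 5 ≡ first k × output σ ≡ o

    nodeCost : ℕ → ℕ
    nodeCost d = 2 + (2 + ((d * 19 + 15) + (4 + ((d * 12 + 5) + (2 + (3 + 4))))))

    printNode-correct : ∀ k o σ → AtNode k o σ → Exec printNode σ (nodeCost (windowLength k)) (AtNode (suc k) (o ++ block k))
    printNode-correct k o σ (fr , keq , peq , oeq) =
      print ▷ setReg ▷ (findFirst-correct k _ fr keq peq peq (o ∷ʳ k) (cong₂ _∷ʳ_ oeq keq) then
      λ τ (fr , keq , peq , qeq , oeq) → print ▷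
        (printRemoved-correct k (first k) (first (suc k)) (windowLength k) _ fr keq peq qeq (m+[n∸m]≡n q≤q′)
          ((o ∷ʳ k) ∷ʳ windowLength k) (cong₂ _∷ʳ_ oeq (cong₂ _∸_ qeq peq)) then
      λ υ (fr@(_ , Aeq , _) , keq , peq , oeq) → print ▷ print ▷ done setReg
        (fr , cong suc keq , peq ,
         trans (cong₂ (λ o a → (o ∷ʳ 1) ∷ʳ a) oeq (cong₂ (λ A k → A k) Aeq keq)) (assemble (segment A (first k) (windowLength k))))))
      where
      open Advanced (first-advanced k) using (q≤q′)
      assemble : ∀ w → ((((o ∷ʳ k) ∷ʳ windowLength k) ++ w) ∷ʳ 1) ∷ʳ A k ≡ o ++ k ∷ windowLength k ∷ w ++ 1 ∷ A k ∷ []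
      assemble w = begin
        ((((o ∷ʳ k) ∷ʳ windowLength k) ++ w) ∷ʳ 1) ∷ʳ A k    ≡⟨ ++-assoc (((o ∷ʳ k) ∷ʳ windowLength k) ++ w) _ _ ⟩
        (((o ∷ʳ k) ∷ʳ windowLength k) ++ w) ++ 1 ∷ A k ∷ []  ≡⟨ ++-assoc ((o ∷ʳ k) ∷ʳ windowLength k) w _ ⟩
        ((o ∷ʳ k) ∷ʳ windowLength k) ++ w ++ 1 ∷ A k ∷ []    ≡⟨ ∷ʳ-++ (o ∷ʳ k) (windowLength k) _ ⟩
        (o ∷ʳ k) ++ windowLength k ∷ w ++ 1 ∷ A k ∷ []       ≡⟨ ∷ʳ-++ o k _ ⟩
        o ++ k ∷ windowLength k ∷ w ++ 1 ∷ A k ∷ []          ∎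
        where open ≡-Reasoning

    -- Each vertex is removed at most once, hence the windows have total length at most n.
    nodes-cost : ∀ m d g → 5 + (nodeCost d + ((m * 50 + g * 40) + 5)) ≤ (suc m * 50 + (d + g) * 40) + 5
    nodes-cost m d g = begin
      5 + (nodeCost d + ((m * 50 + g * 40) + 5))    ≡⟨ left m d g ⟩
      (47 + d * 31) + (m * 50 + g * 40)             ≤⟨ +-monoˡ-≤ _ (+-mono-≤ {47} {55} ≤-literal (*-monoʳ-≤ d {31} {40} ≤-literal)) ⟩
      (55 + d * 40) + (m * 50 + g * 40)             ≡⟨ right m d g ⟩
      (suc m * 50 + (d + g) * 40) + 5               ∎
      where
      open ≤-Reasoning
      open +-*-Solver
      left : ∀ m d g → 5 + (nodeCost d + ((m * 50 + g * 40) + 5)) ≡ (47 + d * 31) + (m * 50 + g * 40)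
      left = solve 3 (λ m d g → con 5 :+ (
          (con 2 :+ (con 2 :+ ((d :* con 19 :+ con 15) :+ (con 4 :+ ((d :* con 12 :+ con 5) :+ (con 2 :+ (con 3 :+ con 4)))))))
                                :+ ((m :* con 50 :+ g :* con 40) :+ con 5))
                             := (con 47 :+ d :* con 31) :+ (m :* con 50 :+ g :* con 40)) refl
      right : ∀ m d g → (55 + d * 40) + (m * 50 + g * 40) ≡ (suc m * 50 + (d + g) * 40) + 5
      right = solve 3 (λ m d g → (con 55 :+ d :* con 40) :+ (m :* con 50 :+ g :* con 40)
                             := ((con 50 :+ m :* con 50) :+ (d :+ g) :* con 40) :+ con 5) refl

    printTree-correct : ∀ σ → Frame σ → output σ ≡ [] →
      Exec printTree σ (4 + (2 + (2 + (2 + (2 + (2 + ((n * 50 + n * 40) + 5)))))))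
        (λ τ → Frame τ × output τ ≡ suc n ∷ 0 ∷ 0 ∷ 0 ∷ concat (segment block 0 n))
    printTree-correct σ fr@(neq , _) oeq = print ▷ print ▷ print ▷ print ▷ setReg ▷ setReg ▷
      while-rule Inv Q turn _ _
        (0 , n , (fr , refl , refl , refl) , refl ,
         cong₂ (λ o n′ → (((((o ∷ʳ suc n′) ∷ʳ 0) ∷ʳ 0) ∷ʳ 0) ++ concat (segment block 0 n))) oeq neq , ≤-refl)
      where
      target = suc n ∷ 0 ∷ 0 ∷ 0 ∷ concat (segment block 0 n)
      Q : State → Set
      Q τ = Frame τ × output τ ≡ target
      -- Amortised budget: 50 for each node still to be printed and 40 for each position not yet
      -- passed by `first`, which pays for finding and printing the windows.
      Inv : ℕ → State → Set
      Inv φ σ = ∃[ k ] ∃[ m ] (AtNode k (output σ) σ × k + m ≡ n × output σ ++ concat (segment block k m) ≡ target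
                            × (m * 50 + (n ∸ first k) * 40) + 5 ≤ φ)
      turn : ∀ φ σ → Inv φ σ →
          (⟦ reg 7 <ᴺ reg 0 ⟧ᴮ σ ≡ false × 5 ≤ φ × Q σ) ⊎
          (⟦ reg 7 <ᴺ reg 0 ⟧ᴮ σ ≡ true × ∃[ c ] ∃[ φ′ ] (5 + (c + φ′) ≤ φ × Exec printNode σ c (Inv φ′)))
      turn φ σ (k , zero , (fr@(neq , _) , keq , _) , sum , oeq , le) =
        inj₁ (≥⇒test (≤-reflexive (trans neq (trans (sym sum) (trans (+-identityʳ k) (sym keq))))) ,
              ≤-trans (m≤n+m 5 _) le , fr , trans (sym (++-identityʳ _)) oeq)
      turn φ σ (k , suc m , at@(fr@(neq , _) , keq , _) , sum , oeq , le) =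
        inj₂ (<⇒test (subst₂ _<_ (sym keq) (sym neq) k<n) , nodeCost (windowLength k) , (m * 50 + (n ∸ first (suc k)) * 40) + 5 ,
              ≤-trans (subst (λ g → 5 + (nodeCost (windowLength k) +
                                     ((m * 50 + (n ∸ first (suc k)) * 40) + 5)) ≤ (suc m * 50 + g * 40) + 5)
                         lengths (nodes-cost m (windowLength k) (n ∸ first (suc k)))) le ,
              step (printNode-correct k (output σ) σ at))
        where
        open Advanced (first-advanced k)
        k<n : k < n
        k<n = subst (k <_) sum (m<m+n k z<s)
        lengths : windowLength k + (n ∸ first (suc k)) ≡ n ∸ first k
        lengths = trans (+-comm (windowLength k) _) (trans (sym (+-∸-assoc (n ∸ first (suc k)) q≤q′))
                    (cong (_∸ first k) (m∸n+n≡m (≤-trans q′≤k (<⇒≤ k<n)))))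
        step : ∀ {c} → Exec printNode σ c (AtNode (suc k) (output σ ++ block k)) →
               Exec printNode σ c (Inv ((m * 50 + (n ∸ first (suc k)) * 40) + 5))
        step (exec r w (fr , keq , peq , oeq′)) = exec r w
          (suc k , m , (fr , keq , peq , refl) , trans (sym (+-suc k m)) sum ,
           trans (cong (_++ concat (segment block (suc k) m)) oeq′) (trans (++-assoc (output σ) (block k) _) oeq) , ≤-refl)

    printLayers-correct : ∀ σ → Frame σ → ∀ o → output σ ≡ o →
      Exec printLayers σ (2 + (n * 12 + 5)) (λ τ → output τ ≡ o ++ segment L 0 n)
    printLayers-correct σ fr o oeq = setReg ▷ finish (for-rule Inv 7 exit turn n _ (fr , refl , cong (_++ segment L 0 n) oeq))
      where
      Inv : ℕ → State → Set
      Inv m σ = Frame σ × regs σ 7 + m ≡ n × output σ ++ segment L (regs σ 7) m ≡ o ++ segment L 0 n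
      exit : ∀ σ → Inv 0 σ → ⟦ reg 7 <ᴺ reg 0 ⟧ᴮ σ ≡ false
      exit σ ((neq , _) , rem , _) = ≥⇒test (≤-reflexive (trans neq (trans (sym rem) (+-identityʳ _))))
      turn : ∀ m σ → Inv (suc m) σ → ⟦ reg 7 <ᴺ reg 0 ⟧ᴮ σ ≡ true ×
             Exec (print (arr 2 (reg 7)) ⨾ incr 7) σ 7 (Inv m)
      turn m σ (fr@(neq , _ , Leq , _) , rem , oeq) =
        <⇒test (subst (regs σ 7 <_) (trans rem (sym neq)) (m<m+n _ z<s)) ,
        (print ▷ done setReg (fr , trans (sym (+-suc _ m)) rem ,
          trans (∷ʳ-++ (output σ) _ _) (trans (cong (λ a → output σ ++ a ∷ segment L (suc (regs σ 7)) m) (cong (λ L → L (regs σ 7)) Leq)) oeq)))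
      finish : ∀ {P σ b} → Exec P σ b (Inv 0) → Exec P σ b (λ τ → output τ ≡ o ++ segment L 0 n)
      finish (exec r w (_ , _ , oeq)) = exec r w (trans (sym (++-identityʳ _)) oeq)

pad-toℕ : {A : Set} {n : ℕ} (d : A) (f : Fin n → A) (i : Fin n) → pad d f (toℕ i) ≡ f i
pad-toℕ d f zero    = refl
pad-toℕ d f (suc i) = pad-toℕ d (f ∘ suc) i

segment-tabulate : {A : Set} (f : ℕ → A) (k m : ℕ) → segment f k m ≡ tabulate {n = m} (λ i → f (k + toℕ i))
segment-tabulate f k zero    = refl
segment-tabulate f k (suc m) = cong₂ _∷_ (cong f (sym (+-identityʳ k)))
  (trans (segment-tabulate f (suc k) m) (tabulate-cong (λ i → cong f (sym (+-suc k (toℕ i))))))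

∣-∣≤1 : ∀ m n → m ≤ suc n → n ≤ suc m → ∣ m - n ∣ ≤ 1
∣-∣≤1 zero    n       _       h       = h
∣-∣≤1 (suc m) zero    h       _       = h
∣-∣≤1 (suc m) (suc n) (s≤s h) (s≤s g) = ∣-∣≤1 m n h g

-- The path is a tree, and convex sets of its nodes are connected.

module StraightWalk (w : ℕ → ℕ) (N : ℕ)
  (steps : ∀ m → m < N → w (suc m) ≡ suc (w m) ⊎ w m ≡ suc (w (suc m)))
  (noTurn : ∀ m → suc m < N → w (suc (suc m)) ≢ w m) where

  -- A step back down would return to the place visited two steps before.
  up : w 1 ≡ suc (w 0) → ∀ m → m < N → w (suc m) ≡ suc (w m)
  up first zero    m<N = first
  up first (suc m) m<N with steps (suc m) m<N
  ... | inj₁ eq = eq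
  ... | inj₂ eq = ⊥-elim (noTurn m m<N (suc-injective (trans (sym eq) (up first m (<⇒≤ m<N)))))

  down : w 0 ≡ suc (w 1) → ∀ m → m < N → w m ≡ suc (w (suc m))
  down first zero    m<N = first
  down first (suc m) m<N with steps (suc m) m<N
  ... | inj₂ eq = eq
  ... | inj₁ eq = ⊥-elim (noTurn m m<N (trans eq (sym (down first m (<⇒≤ m<N)))))

  ascent : w 1 ≡ suc (w 0) → ∀ m → m ≤ N → w m ≡ w 0 + m
  ascent first zero    _   = sym (+-identityʳ _)
  ascent first (suc m) m<N = trans (up first m m<N) (trans (cong suc (ascent first m (<⇒≤ m<N))) (sym (+-suc _ m)))

  descent : w 0 ≡ suc (w 1) → ∀ m → m ≤ N → w m + m ≡ w 0
  descent first zero    _   = +-identityʳ _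
  descent first (suc m) m<N = trans (+-suc _ m) (trans (cong (_+ m) (sym (down first m m<N))) (descent first m (<⇒≤ m<N)))

  -- A walk that never turns ends at distance N ≥ 2 from its start, too far to close up by a single
  -- edge.
  notClosed : 2 ≤ N → ¬ (w 0 ≡ suc (w N) ⊎ w N ≡ suc (w 0))
  notClosed 2≤N close with steps 0 (<⇒≤ 2≤N) | close
  ... | inj₁ eq | inj₁ c rewrite ascent eq N ≤-refl = m≢1+m+n (w 0) c
  ... | inj₁ eq | inj₂ c = <⇒≱ 2≤N (≤-reflexive (+-cancelˡ-≡ (w 0) N 1 (trans (sym (ascent eq N ≤-refl)) (trans c (+-comm 1 (w 0))))))
  ... | inj₂ eq | inj₁ c = <⇒≱ 2≤N (≤-reflexive (+-cancelˡ-≡ (w N) N 1 (trans (descent eq N ≤-refl) (trans c (+-comm 1 (w N))))))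
  ... | inj₂ eq | inj₂ c = m≢1+m+n (w 0) (trans (sym (descent eq N ≤-refl)) (cong (_+ N) c))

module Path (n : ℕ) where

  parent : Fin (suc n) → Fin (suc n)
  parent zero    = zero
  parent (suc i) = inject₁ i

  -- The root contributes the pair `(zero , zero)`, which `fromEdges` discards as a loop; thus all
  -- nodes can be listed alike.
  pathEdges : List (Fin (suc n) × Fin (suc n))
  pathEdges = map (λ t → parent t , t) (allFin (suc n))

  path : Graph (Fin (suc n))
  path = fromEdges pathEdges

  edge⁺ : ∀ t → (parent t , t) List.∈ pathEdges
  edge⁺ t = ∈-map⁺ (λ t → parent t , t) (∈-allFin t)

  edge⁻ : ∀ {s t} → (s , t) List.∈ pathEdges → parent t ≡ s
  edge⁻ e with ∈-map⁻ (λ t → parent t , t) e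
  ... | _ , _ , refl = refl

  adjacent⇔parent : ∀ s t → Adj path s t ⇔ (s ≢ t × (parent s ≡ t ⊎ parent t ≡ s))
  adjacent⇔parent s t = mk⇔
    (λ { (s≢t , inj₁ e) → s≢t , inj₂ (edge⁻ e) ; (s≢t , inj₂ e) → s≢t , inj₁ (edge⁻ e) })
    (λ { (s≢t , inj₁ refl) → s≢t , inj₂ (edge⁺ s) ; (s≢t , inj₂ refl) → s≢t , inj₁ (edge⁺ t) })

  i≢1+i : (i : Fin n) → _≢_ {A = Fin (suc n)} (suc i) (inject₁ i)
  i≢1+i i eq = 1+n≢n (trans (cong toℕ eq) (toℕ-inject₁ i))

  parent-step : ∀ s t → s ≢ t → parent t ≡ s → toℕ t ≡ suc (toℕ s)
  parent-step s zero    s≢t eq = ⊥-elim (s≢t (sym eq))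
  parent-step s (suc i) s≢t eq = cong suc (trans (sym (toℕ-inject₁ i)) (cong toℕ eq))

  adjacent-step : ∀ s t → Adj path s t → toℕ t ≡ suc (toℕ s) ⊎ toℕ s ≡ suc (toℕ t)
  adjacent-step s t (s≢t , inj₁ e) = inj₁ (parent-step s t s≢t (edge⁻ e))
  adjacent-step s t (s≢t , inj₂ e) = inj₂ (parent-step t s (s≢t ∘ sym) (edge⁻ e))

  acyclic : ¬ Cycle path
  acyclic C = StraightWalk.notClosed w (2 + k) step noTurn (s≤s (s≤s z≤n)) close
    where
    open Cycle C
    w : ℕ → ℕ
    -- The default 0 lies beyond the last vertex of the cycle and is never reached: arguments stay
    -- below `3 + k`.
    w = pad 0 (toℕ ∘ vertex)
    at : ∀ i m → toℕ i ≡ m → w m ≡ toℕ (vertex i)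
    at i _ refl = pad-toℕ 0 (toℕ ∘ vertex) i
    step : ∀ m → m < 2 + k → w (suc m) ≡ suc (w m) ⊎ w m ≡ suc (w (suc m))
    step m m<N rewrite at (inject₁ (fromℕ< m<N)) m (trans (toℕ-inject₁ _) (toℕ-fromℕ< m<N))
                     | at (suc (fromℕ< m<N)) (suc m) (cong suc (toℕ-fromℕ< m<N))
      = adjacent-step _ _ (steps (fromℕ< m<N))
    noTurn : ∀ m → suc m < 2 + k → w (suc (suc m)) ≢ w m
    noTurn m m<N eq = <⇒≢ (m<n+m m {2} z<s) (trans (sym (toℕ-fromℕ< m<)) (trans (cong toℕ (sym same)) (toℕ-fromℕ< 2+m<)))
      where
      2+m< : 2 + m < 3 + k
      2+m< = s≤s m<N
      m< : m < 3 + k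
      m< = ≤-trans (n≤1+n _) (<⇒≤ 2+m<)
      same : fromℕ< 2+m< ≡ fromℕ< m<
      same = distinct (toℕ-injective (trans (sym (at _ _ (toℕ-fromℕ< 2+m<))) (trans eq (at _ _ (toℕ-fromℕ< m<)))))
    close : w 0 ≡ suc (w (2 + k)) ⊎ w (2 + k) ≡ suc (w 0)
    close rewrite at (fromℕ (2 + k)) (2 + k) (toℕ-fromℕ (2 + k)) = adjacent-step _ _ closing

  module _ (P : Fin (suc n) → Set) (irrelevant : ∀ {t} (a b : P t) → a ≡ b)
           (convex : ∀ s i → toℕ s ≤ toℕ i → P s → P (suc i) → P (inject₁ i)) where

    private
      -- Convexity keeps the walk from parent to parent inside `P`. Nodes of an induced subgraph
      -- carry proofs of membership, so on arrival the proof at hand has to be identified with `ps`.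
      descend : ∀ d s t (ps : P s) (pt : P t) → toℕ t ≡ toℕ s + d → Star (Adj (path [ P ])) (t , pt) (s , ps)
      descend zero s t ps pt eq with toℕ-injective {i = t} {j = s} (trans eq (+-identityʳ _))
      ... | refl rewrite irrelevant pt ps = ε
      descend (suc d) s zero ps pt eq with () ← trans eq (+-suc (toℕ s) d)
      descend (suc d) s (suc i) ps pt eq =
        (i≢1+i i , inj₂ (edge⁺ (suc i))) ◅ descend d s (inject₁ i) ps (convex s i s≤i ps pt) (trans (toℕ-inject₁ i) i≡)
        where
        i≡ : toℕ i ≡ toℕ s + d
        i≡ = suc-injective (trans eq (+-suc (toℕ s) d))
        s≤i : toℕ s ≤ toℕ i
        s≤i = subst (toℕ s ≤_) (sym i≡) (m≤m+n _ d)

    connectedOn : Connected (path [ P ])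
    connectedOn (s , ps) (t , pt) with ≤-total (toℕ s) (toℕ t)
    ... | inj₁ s≤t = reverse (λ {u} {v} → symmetric (path [ P ]) {u} {v}) (descend _ s t ps pt (sym (m+[n∸m]≡n s≤t)))
    ... | inj₂ t≤s = descend _ t s pt ps (sym (m+[n∸m]≡n t≤s))

  isPathTree : IsTree path
  isPathTree = record
    { node = zero
    ; connected = λ s t → gmap proj₁ id (connectedOn (λ _ → ⊤) (λ _ _ → refl) (λ _ _ _ _ _ → tt) (s , tt) (t , tt))
    ; acyclic = acyclic }

-- Extrema and subsets by excluded middle.

module Classical (R : Reals) where
  open OrderedField R using (excludedMiddle)

  -- Descending search from the bound. It supplies the exact maxima that `α≤` and `IsLayeredWidth`
  -- ask for.
  boundedMax : (P : ℕ → Set) → ∃ P → ∀ b → (∀ j → P j → j ≤ b) → ∃[ k ] (IsMax P k × k ≤ b)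
  boundedMax P (j , pj) zero bound = 0 , (subst P (n≤0⇒n≡0 (bound j pj)) pj , bound) , z≤n
  boundedMax P ne (suc b) bound with excludedMiddle (P (suc b))
  ... | inj₁ p = suc b , (p , bound) , ≤-refl
  ... | inj₂ ¬p with boundedMax P ne b (λ j pj → ≤-pred (≤∧≢⇒< (bound j pj) λ { refl → ¬p pj }))
  ...   | k , max , k≤b = k , max , m≤n⇒m≤1+n k≤b

  -- The second alternative carries the induction: if nothing holds below `b`, a hit at `b` is
  -- minimal.
  minOrNone : (P : ℕ → Set) → ∀ b → (∃[ k ] (IsMin P k × k < b)) ⊎ (∀ j → j < b → ¬ P j)
  minOrNone P zero = inj₂ λ _ ()
  minOrNone P (suc b) with minOrNone P b
  ... | inj₁ (k , min , k<b) = inj₁ (k , min , m<n⇒m<1+n k<b)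
  ... | inj₂ none with excludedMiddle (P b)
  ...   | inj₁ p = inj₁ (b , (p , λ j pj → ≮⇒≥ λ j<b → none j j<b pj) , ≤-refl)
  ...   | inj₂ ¬p = inj₂ λ j j<sb pj → [ (λ j<b → none j j<b pj) , (λ { refl → ¬p pj }) ]′ (m<1+n⇒m<n∨m≡n j<sb)

  minimum : (P : ℕ → Set) → ∀ b → P b → ∃[ k ] (IsMin P k × k ≤ b)
  minimum P b pb with minOrNone P (suc b)
  ... | inj₁ (k , min , s≤s k≤b) = k , min , k≤b
  ... | inj₂ none = ⊥-elim (none b ≤-refl pb)

  -- A bag is a Boolean vector while its membership condition is a proposition about reals; this is
  -- the passage between them.
  subsetOf : ∀ {n} → (Fin n → Set) → Subset n
  subsetOf P = Vec.tabulate (λ v → [ (λ _ → true) , (λ _ → false) ]′ (excludedMiddle (P v)))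

  ∈-subsetOf⁻ : ∀ {n} (P : Fin n → Set) {v} → v ∈ subsetOf P → P v
  ∈-subsetOf⁻ P {v} v∈ with excludedMiddle (P v)
    | trans (sym (lookup∘tabulate (λ v → [ (λ _ → true) , (λ _ → false) ]′ (excludedMiddle (P v))) v))
            ([]=⇒lookup v∈)
  ... | inj₁ p | _ = p
  ... | inj₂ _ | ()

  ∈-subsetOf⁺ : ∀ {n} (P : Fin n → Set) {v} → P v → v ∈ subsetOf P
  ∈-subsetOf⁺ P {v} p = lookup⇒[]= v _ (trans (lookup∘tabulate _ v) lem)
    where
    lem : [ (λ _ → true) , (λ _ → false) ]′ (excludedMiddle (P v)) ≡ true
    lem with excludedMiddle (P v)
    ... | inj₁ _ = refl
    ... | inj₂ ¬p = ⊥-elim (¬p p)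

-- The path decomposition and its description by differences.

module PathDecomposition (R : Reals) (K : ℕ → Reals.Carrier R) (s : Reals.Carrier R) (0<s : Reals._<ʳ_ R (Reals.0ʳ R) s)
    (n : ℕ) (A : ℕ → ℕ) (enum : SortedEnumeration R K n A) (G : Graph (Fin n))
    (short : ∀ u v → Adj G u v → Reals._≤ʳ_ R (K (toℕ u)) (Reals._+ʳ_ R (K (toℕ v)) s)) where
  open Reals R using (_≤ʳ_; _<ʳ_; _+ʳ_)
  open OrderedField R
  open Classical R
  open Path n
  open SortedEnumeration enum
  open Window R K s 0<s n A enum using (first; windowLength; first≤; first-advanced; before-first; from-first; Advanced)
    renaming (block to nodeBlock)
  open GreedyLayers R K s 0<s n A enum using (≤-shift)

  Seen : ℕ → Fin n → Set
  Seen k v = ∃[ p ] (p ≤ k × A p ≡ toℕ v)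

  -- The empty root provides a node when `n = 0` and shifts the numbering: node `suc k` belongs to
  -- the vertex at position `k`, which its bag contains.
  InBag : ℕ → Fin n → Set
  InBag zero    v = ⊥
  InBag (suc k) v = Seen k v × K (A k) ≤ʳ K (toℕ v) +ʳ s

  seen≤ : ∀ {k v} → k < n → Seen k v → K (toℕ v) ≤ʳ K (A k)
  seen≤ k<n (p , p≤k , eq) = subst (λ u → K u ≤ʳ K (A _)) eq (sorted p _ p≤k k<n)

  -- All keys in the bag lie between `K (A k)` - s and `K (A k)`.
  bag-near : ∀ t u v → t ≤ n → InBag t u → InBag t v → K (toℕ u) ≤ʳ K (toℕ v) +ʳ s
  bag-near (suc k) u v k<n (su , _) (_ , nv) = ≤ʳ-trans (seen≤ k<n su) nv

  inBag-last : ∀ k (u v : Fin n) → k < n → A k ≡ toℕ v → K (toℕ v) ≤ʳ K (toℕ u) +ʳ s → Seen k u → InBag (suc k) u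
  inBag-last k u v k<n eq near su = su , subst (λ a → K a ≤ʳ K (toℕ u) +ʳ s) (sym eq) near

  bags : Fin (suc n) → Subset n
  bags t = subsetOf (InBag (toℕ t))

  inBag : ∀ {t v} → v ∈ bags t → InBag (toℕ t) v
  inBag {t} = ∈-subsetOf⁻ (InBag (toℕ t))

  toBag : ∀ {t v} → InBag (toℕ t) v → v ∈ bags t
  toBag {t} = ∈-subsetOf⁺ (InBag (toℕ t))

  bagNode : ∀ k → k < n → ∃[ t ] toℕ {suc n} t ≡ suc k
  bagNode k k<n = suc (fromℕ< k<n) , cong suc (toℕ-fromℕ< k<n)

  -- The node of whichever vertex comes later in the order holds both. With `u = v` this also covers
  -- single vertices.
  common : ∀ u v → K (toℕ u) ≤ʳ K (toℕ v) +ʳ s → K (toℕ v) ≤ʳ K (toℕ u) +ʳ s → ∃[ t ] (u ∈ bags t × v ∈ bags t)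
  common u v uv vu with covers (toℕ u) (toℕ<n u) | covers (toℕ v) (toℕ<n v)
  ... | p , p<n , eqᵤ | q , q<n , eqᵥ with ≤-total p q
  ...   | inj₁ p≤q = let (t , eq) = bagNode q q<n in t ,
            toBag (subst (λ m → InBag m u) (sym eq) (inBag-last q u v q<n eqᵥ vu (p , p≤q , eqᵤ))) ,
            toBag (subst (λ m → InBag m v) (sym eq) (inBag-last q v v q<n eqᵥ ≤-shift (q , ≤-refl , eqᵥ)))
  ...   | inj₂ q≤p = let (t , eq) = bagNode p p<n in t ,
            toBag (subst (λ m → InBag m u) (sym eq) (inBag-last p u u p<n eqᵤ ≤-shift (p , ≤-refl , eqᵤ))) ,
            toBag (subst (λ m → InBag m v) (sym eq) (inBag-last p v u p<n eqᵤ uv (q , q≤p , eqᵥ)))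

  -- Having been seen persists to later nodes, being near persists to earlier ones; so the nodes of
  -- a vertex form an interval.
  inBag-convex : ∀ v k l → k ≤ l → l < n → InBag k v → InBag (suc l) v → InBag l v
  inBag-convex v (suc k) (suc l) (s≤s k≤l) l<n ((p , p≤k , eq) , _) (_ , near) =
    (p , ≤-trans p≤k k≤l , eq) , ≤ʳ-trans (sorted l (suc l) (n≤1+n l) l<n) near

  decomposition : TreeDecomposition G
  decomposition = record
    { size = suc n ; edges = pathEdges ; bag = bags ; isTree = isPathTree
    ; coversVertices = λ v → let (t , v∈ , _) = common v v ≤-shift ≤-shift in t , v∈
    ; coversEdges = λ u v adj → common u v (short u v adj) (short v u (symmetric G adj))
    ; connectedNodes = λ v → connectedOn (λ t → v ∈ bags t) []=-irrelevant
        (λ s i s≤i ps pi → toBag (subst (λ m → InBag m v) (sym (toℕ-inject₁ i))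
          (inBag-convex v (toℕ s) (toℕ i) s≤i (toℕ<n i) (inBag ps) (inBag pi)))) }

  vertices : ∀ p m → p + m ≤ n → List (Fin n)
  vertices p zero    _ = []
  vertices p (suc m) h = fromℕ< (range p (≤-trans (m<m+n p z<s) h)) ∷ vertices (suc p) m (subst (_≤ n) (+-suc p m) h)

  map-vertices : ∀ p m h → map toℕ (vertices p m h) ≡ segment A p m
  map-vertices p zero    h = refl
  map-vertices p (suc m) h = cong₂ _∷_ (toℕ-fromℕ< _) (map-vertices (suc p) m _)

  length-vertices : ∀ p m h → length (vertices p m h) ≡ m
  length-vertices p zero    h = refl
  length-vertices p (suc m) h = cong suc (length-vertices (suc p) m _)

  ∈-vertices⁺ : ∀ p m h r v → p ≤ r → r < p + m → A r ≡ toℕ v → v List.∈ vertices p m h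
  ∈-vertices⁺ p zero    h r v p≤r r<p eq = ⊥-elim (<⇒≱ r<p (≤-trans (≤-reflexive (+-identityʳ p)) p≤r))
  ∈-vertices⁺ p (suc m) h r v p≤r r<p eq with m≤n⇒m<n∨m≡n p≤r
  ... | inj₂ refl = here (toℕ-injective (trans (sym eq) (sym (toℕ-fromℕ< _))))
  ... | inj₁ p<r  = there (∈-vertices⁺ (suc p) m _ r v p<r (subst (r <_) (+-suc p m) r<p) eq)

  ∈-vertices⁻ : ∀ p m h v → v List.∈ vertices p m h → ∃[ r ] (p ≤ r × r < p + m × A r ≡ toℕ v)
  ∈-vertices⁻ p (suc m) h v (here refl) = p , ≤-refl , m<m+n p z<s , sym (toℕ-fromℕ< _)
  ∈-vertices⁻ p (suc m) h v (there v∈) with ∈-vertices⁻ (suc p) m _ v v∈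
  ... | r , p<r , r< , eq = r , <⇒≤ p<r , subst (r <_) (sym (+-suc p m)) r< , eq

  window-end : ∀ k → first k + windowLength k ≡ first (suc k)
  window-end k = m+[n∸m]≡n (Advanced.q≤q′ (first-advanced k))

  window≤n : ∀ k → k < n → first k + windowLength k ≤ n
  window≤n k k<n = ≤-trans (≤-reflexive (window-end k)) (≤-trans (first≤ (suc k)) k<n)

  removedAt : ∀ k → k < n → List (Fin n)
  removedAt k k<n = vertices (first k) (windowLength k) (window≤n k k<n)

  -- A vertex other than the newest was near already one step earlier. It is not in the removed
  -- window, since the vertices there are too far left of `A k`.
  bag-forward : ∀ k (k<n : k < n) v → InBag (suc k) v →
                (InBag k v × ¬ (v List.∈ removedAt k k<n)) ⊎ A k ≡ toℕ v
  bag-forward k k<n v ((p , p≤k , eq) , near) with m≤n⇒m<n∨m≡n p≤k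
  ... | inj₂ refl = inj₂ eq
  bag-forward (suc k) k<n v ((p , _ , eq) , near) | inj₁ (s≤s p≤k) = inj₁
    ( ((p , p≤k , eq) , ≤ʳ-trans (sorted k (suc k) (n≤1+n k) k<n) near)
    , λ v∈ → let (r , _ , r< , eq′) = ∈-vertices⁻ _ _ _ v v∈ in
        ≤ʳ⇒≯ near (subst (λ u → K u +ʳ s <ʳ K (A (suc k))) eq′
          (before-first (suc k) r k<n (<-≤-trans r< (≤-reflexive (window-end (suc k)))))))

  -- Nearness one step earlier puts the position of `v` at or after the old start; as `v` is outside
  -- the removed window, it is at or after the new start too.
  bag-backward : ∀ k (k<n : k < n) v → InBag k v → ¬ (v List.∈ removedAt k k<n) → InBag (suc k) v
  bag-backward (suc k) k<n v ((p , p≤k , eq) , near) v∉ =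
    (p , m≤n⇒m≤1+n p≤k , eq) ,
    subst (λ u → K (A (suc k)) ≤ʳ K u +ʳ s) eq (from-first (suc k) p k<n (≤-<-trans p≤k (<⇒≤ k<n)) first≤p)
    where
    f≤p : first (suc k) ≤ p
    f≤p = ≮⇒≥ λ p<f → ≤ʳ⇒≯ near (subst (λ u → K u +ʳ s <ʳ K (A k)) eq (before-first k p (<⇒≤ k<n) p<f))
    first≤p : first (suc (suc k)) ≤ p
    first≤p = ≮⇒≥ λ p<f → v∉ (∈-vertices⁺ _ _ _ p v f≤p (<-≤-trans p<f (≤-reflexive (sym (window-end (suc k))))) eq)

  vertexAt : Fin n → Fin n
  vertexAt k = fromℕ< (range (toℕ k) (toℕ<n k))

  toℕ-vertexAt : ∀ k → toℕ (vertexAt k) ≡ A (toℕ k)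
  toℕ-vertexAt k = toℕ-fromℕ< _

  removedOf addedOf : Fin (suc n) → List (Fin n)
  removedOf zero    = []
  removedOf (suc k) = removedAt (toℕ k) (toℕ<n k)
  addedOf zero    = []
  addedOf (suc k) = vertexAt k ∷ []

  description : Description decomposition
  description = record
    { parent = parent ; removed = removedOf ; added = addedOf
    ; parent-first = λ { zero → z≤n ; (suc i) → ≤-reflexive (toℕ-inject₁ i) }
    ; tree-edges = adjacent⇔parent
    ; bag-update = λ { zero v → mk⇔ (λ v∈ → ⊥-elim (inBag {zero} v∈))
                                    (λ { (inj₁ (0≢0 , _)) → ⊥-elim (0≢0 refl) ; (inj₂ ()) })
                     ; (suc k) v → mk⇔ (to k v) (from k v) } }
    where
    Updated : ∀ k v → Set
    Updated k v = (suc k ≢ inject₁ k × v ∈ bags (inject₁ k) × ¬ (v List.∈ removedOf (suc k))) ⊎ v List.∈ addedOf (suc k)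
    to : ∀ k v → v ∈ bags (suc k) → Updated k v
    to k v v∈ with bag-forward (toℕ k) (toℕ<n k) v (inBag v∈)
    ... | inj₁ (b , v∉) = inj₁ (i≢1+i k , toBag (subst (λ m → InBag m v) (sym (toℕ-inject₁ k)) b) , v∉)
    ... | inj₂ eq       = inj₂ (here (toℕ-injective (trans (sym eq) (sym (toℕ-vertexAt k)))))
    from : ∀ k v → Updated k v → v ∈ bags (suc k)
    from k v (inj₁ (_ , v∈ , v∉)) =
      toBag (bag-backward (toℕ k) (toℕ<n k) v (subst (λ m → InBag m v) (toℕ-inject₁ k) (inBag v∈)) v∉)
    from k v (inj₂ (here refl)) =
      toBag {suc k} (inBag-last (toℕ k) v v (toℕ<n k) (sym (toℕ-vertexAt k)) ≤-shift (toℕ k , ≤-refl , sym (toℕ-vertexAt k)))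

  block-suc : ∀ k → Description.block description (suc k) ≡ nodeBlock (toℕ k)
  block-suc k rewrite toℕ-inject₁ k | toℕ-vertexAt k
                    | length-vertices (first (toℕ k)) (windowLength (toℕ k)) (window≤n (toℕ k) (toℕ<n k))
                    | map-vertices (first (toℕ k)) (windowLength (toℕ k)) (window≤n (toℕ k) (toℕ<n k)) = refl

  serialized : (ℒ : Layering G) (L : ℕ → ℕ) → (∀ v → layer ℒ v ≡ L (toℕ v)) →
    serialize decomposition description ℒ ≡ (suc n ∷ 0 ∷ 0 ∷ 0 ∷ concat (segment nodeBlock 0 n)) ++ segment L 0 n
  serialized ℒ L eq = cong (λ xs → suc n ∷ 0 ∷ 0 ∷ 0 ∷ xs) (cong₂ _++_ (cong concat blocks) layers)
    where
    blocks : map (Description.block description) (tabulate suc) ≡ segment nodeBlock 0 n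
    blocks = trans (map-tabulate suc (Description.block description)) (trans (tabulate-cong block-suc) (sym (segment-tabulate nodeBlock 0 n)))
    layers : map (layer ℒ) (allFin n) ≡ segment L 0 n
    layers = trans (map-tabulate id (layer ℒ)) (trans (tabulate-cong eq) (sym (segment-tabulate L 0 n)))

-- The bound 3 on independence numbers.

module Independence (R : Reals) {n : ℕ} (D : UnitDisks.Family R n) where
  open Reals R using (_≤ʳ_; _+ʳ_)
  open OrderedField R using (module FourPoints)
  open Classical R
  open UnitDisks R
  open DiskGeometry R

  private G = intersectionGraph D

  module _ (𝒯 : TreeDecomposition G) (ℒ : Layering G)
    (near-x : ∀ t u v → u ∈ bag 𝒯 t → v ∈ bag 𝒯 t → xs D u ≤ʳ xs D v +ʳ diameter D)
    (near-y : ∀ u v → layer ℒ u ≡ layer ℒ v → ys D u ≤ʳ ys D v +ʳ diameter D) where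

    independent≤3 : ∀ t i j → HasIndependentSet (bagLayer 𝒯 ℒ t i) j → j ≤ 3
    independent≤3 t i j (f , injective , independent) = ≮⇒≥ λ 3<j →
      let open Four 3<j
          open FourPoints (diameter D) (λ a → xs D (point a)) (λ a → ys D (point a))
                 (λ a b → near-x t _ _ (in-bag a) (in-bag b))
                 (λ a b → near-y _ _ (trans (in-layer a) (sym (in-layer b))))
      in notAllFar zero (suc zero) (suc (suc zero)) (suc (suc (suc zero)))
           (far (λ ())) (far (λ ())) (far (λ ())) (far (λ ())) (far (λ ())) (far (λ ()))
      where
      module Four (3<j : 3 < j) where
        chosen : Fin 4 → Σ (Fin n) (λ v → v ∈ bag 𝒯 t × layer ℒ v ≡ i)
        chosen a = f (inject≤ a 3<j)
        point : Fin 4 → Fin n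
        point a = proj₁ (chosen a)
        in-bag : ∀ a → point a ∈ bag 𝒯 t
        in-bag a = proj₁ (proj₂ (chosen a))
        in-layer : ∀ a → layer ℒ (point a) ≡ i
        in-layer a = proj₂ (proj₂ (chosen a))
        -- The independent set is injective into vertices paired with membership proofs; uniqueness
        -- of these proofs makes the underlying vertices distinct.
        unique : ∀ {u v : Σ (Fin n) (λ v → v ∈ bag 𝒯 t × layer ℒ v ≡ i)} → proj₁ u ≡ proj₁ v → u ≡ v
        unique {_ , p , q} {_ , p′ , q′} refl = cong₂ (λ p q → _ , p , q) ([]=-irrelevant p p′) (≡-irrelevant q q′)
        far : ∀ {a b} → a ≢ b → _
        far {a} {b} a≢b = independent⇒far D {point a} {point b}
          (λ eq → a≢b (inject≤-injective 3<j 3<j a b (injective (unique eq))))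
          (independent (inject≤ a 3<j) (inject≤ b 3<j))

    independenceNumber : ∀ t i → α≤ (bagLayer 𝒯 ℒ t i) 3
    -- The empty set is the independent set from which the maximum is known to exist.
    independenceNumber t i = boundedMax _ (0 , (λ ()) , (λ { {()} }) , λ ()) 3 (independent≤3 t i)

    -- The width is a maximum over infinitely many layer indices; the uniform bound 3 reduces it to
    -- a finite search over values, and this width then bounds the search for the minimum.
    layeredNumber : ∃[ k ] (IsLayeredTreeIndependenceNumber G k × k ≤ 3)
    layeredNumber with boundedMax (λ k → ∃[ t ] ∃[ i ] IsIndependenceNumber (bagLayer 𝒯 ℒ t i) k) some 3
                         (λ { k (t , i , has , _) → independent≤3 t i k has })
      where
      t₀ = IsTree.node (isTree 𝒯)
      some : ∃[ k ] ∃[ t ] ∃[ i ] IsIndependenceNumber (bagLayer 𝒯 ℒ t i) k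
      some = let (k , isα , _) = independenceNumber t₀ 0 in k , t₀ , 0 , isα
    ... | w , width , w≤3 with minimum _ w (𝒯 , ℒ , width)
    ...   | k , min , k≤w = k , min , ≤-trans k≤w w≤3

-- Running time.

n≤2^[1+⌊log₂n⌋] : ∀ n → n ≤ 2 ^ suc ⌊log₂ n ⌋
n≤2^[1+⌊log₂n⌋] n with ≤-total n (2 ^ suc ⌊log₂ n ⌋)
... | inj₁ le = le
... | inj₂ ge = ⊥-elim (<-irrefl refl (≤-trans (≤-reflexive (sym (⌊log₂[2^n]⌋≡n (suc ⌊log₂ n ⌋)))) (⌊log₂⌋-mono-≤ ge)))

-- The sums keep the shape in which the rules add the budgets of the five parts of the program.
sortTime time : ℕ → ℕ
sortTime n = (2 + (n * 20 + 5)) + (2 + (suc ⌊log₂ n ⌋ * (5 + ((2 + (n * 200 + 5)) + ((2 + (n * 20 + 5)) + 4))) + 5))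
time n = sortTime n + ((2 + (2 + (5 + (n * 50 + 5)))) + (sortTime n +
         ((4 + (2 + (2 + (2 + (2 + (2 + ((n * 50 + n * 40) + 5))))))) + (2 + (n * 12 + 5)))))

time-expanded : ∀ n → time n ≡ 114 + n * 632 + ⌊log₂ n ⌋ * 46 + n * ⌊log₂ n ⌋ * 440
time-expanded n = expand n ⌊log₂ n ⌋
  where
  open +-*-Solver
  expand = solve 2 (λ n l →
    let sort = (con 2 :+ (n :* con 20 :+ con 5)) :+ 
               (con 2 :+ ((con 1 :+ l) :* (con 5 :+ ((con 2 :+ (n :* con 200 :+ con 5)) :+ ((con 2 :+ (n :* con 20 :+ con 5)) :+ con 4))) :+ con 5))
    in sort :+ ((con 2 :+ (con 2 :+ (con 5 :+ (n :* con 50 :+ con 5)))) :+ (sort :+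
         ((con 4 :+ (con 2 :+ (con 2 :+ (con 2 :+ (con 2 :+ (con 2 :+ ((n :* con 50 :+ n :* con 40) :+ con 5))))))) :+ (con 2 :+ (n :* con 12 :+ con 5)))))
       := con 114 :+ n :* con 632 :+ l :* con 46 :+ n :* l :* con 440) refl

time∈O : time ∈O (λ n → n * ⌊log₂ n ⌋)
-- 1232 = 114 + 632 + 46 + 440. From `n = 2` on the logarithm is at least 1, so each of 1, n and log
-- n is at most n log n; at `n = 1` that product vanishes.
time∈O = 1232 , 2 , bound
  where
  bound : ∀ n → 2 ≤ n → time n ≤ 1232 * (n * ⌊log₂ n ⌋)
  bound n 2≤n = begin
    time n                                        ≡⟨ time-expanded n ⟩
    114 + n * 632 + l * 46 + n * l * 440          ≤⟨ +-monoˡ-≤ _ (+-mono-≤ (+-mono-≤ (*-monoˡ-≤ 114 1≤nl) (*-monoˡ-≤ 632 n≤nl)) (*-monoˡ-≤ 46 l≤nl)) ⟩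
    nl * 114 + nl * 632 + nl * 46 + nl * 440      ≡⟨ solve 1 (λ x → x :* con 114 :+ x :* con 632 :+ x :* con 46 :+ x :* con 440 := con 1232 :* x) refl nl ⟩
    1232 * nl                                     ∎
    where
    open ≤-Reasoning
    open +-*-Solver
    l  = ⌊log₂ n ⌋
    nl = n * l
    1≤l : 1 ≤ l
    1≤l = ⌊log₂⌋-mono-≤ 2≤n
    n≤nl : n ≤ nl
    n≤nl = ≤-trans (≤-reflexive (sym (*-identityʳ n))) (*-monoʳ-≤ n 1≤l)
    l≤nl : l ≤ nl
    l≤nl = ≤-trans (≤-reflexive (sym (*-identityˡ l))) (*-monoˡ-≤ l (<⇒≤ 2≤n))
    1≤nl : 1 ≤ nl
    1≤nl = ≤-trans 1≤l l≤nl

-- The whole program and the final assembly.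

module Algorithm (R : Reals) where
  open Reals R hiding (_≟_)
  open RealRAM R
  open HoareLogic R
  open UnitDisks R
  open DiskGeometry R
  open OrderedField R

  program : Program
  program = MergeSort.sort R 1 ⨾ LayerProgram.layers R ⨾ MergeSort.sort R 0 ⨾ PrintProgram.printTree R ⨾ PrintProgram.printLayers R

  module _ {n : ℕ} (D : Family n) where

    private
      G  = intersectionGraph D
      X₀ = inputArraysᴿ D

    0<diameter : 0ʳ <ʳ diameter D
    0<diameter = <-≤ʳ-trans (radius-positive D)
      (x≤x+d (inj₁ (radius-positive D)))

    -- The real arrays `X` at the second sort are not the input `X₀` as a whole, the sweep having
    -- written its base into array 3; agreement is recorded for the x-coordinates and the radius.
    record Output (τ : State) : Set where
      field
        A L    : ℕ → ℕ
        X      : ℕ → ℕ → Carrier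
        xs≡    : X 0 ≡ X₀ 0
        rad≡   : X 2 ≡ X₀ 2
        0<s    : 0ʳ <ʳ X 2 0 +ʳ X 2 0
        enum   : SortedEnumeration R (X 0) n A
        compat : ∀ u v → u < n → v < n →
                 (L u ≡ L v → X₀ 1 u ≤ʳ X₀ 1 v +ʳ diameter D) × (suc (L v) < L u → X₀ 1 v +ʳ diameter D <ʳ X₀ 1 u)
        out≡   : output τ ≡ (suc n ∷ 0 ∷ 0 ∷ 0 ∷
                   concat (segment (Window.block R (X 0) (X 2 0 +ʳ X 2 0) 0<s n A enum) 0 n)) ++ segment L 0 n

    program-correct : Exec program (input D) (time n) Output
    program-correct =
      MergeSort.Correctness.sort-correct R 1 n (λ _ → 0) X₀ [] f (n≤2^[1+⌊log₂n⌋] n) (input D) (refl , refl , refl , refl) then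
      λ σ₁ ((neq , _ , Xeq , oeq) , enum₁) →
      LayerProgram.Correctness.layers-correct R n (arrays σ₁ 0) X₀ [] 0<diameter enum₁ σ₁
        (neq , refl , cong (λ X → X 0) Xeq , cong (λ X → X 1) Xeq , cong (λ X → X 2) Xeq , oeq) then
      λ σ₂ ((neq , _ , xs≡ , _ , rad≡ , oeq) , compat) →
      MergeSort.Correctness.sort-correct R 0 n (arrays σ₂ 2) (arraysᴿ σ₂) [] f (n≤2^[1+⌊log₂n⌋] n) σ₂ (neq , refl , refl , oeq) then
      λ σ₃ ((neq , Leq , Xeq , oeq) , enum₃) →
      let 0<s = subst (λ r → 0ʳ <ʳ r 0 +ʳ r 0) (sym rad≡) 0<diameter
          module P = PrintProgram.Correctness R n (arrays σ₃ 0) (arrays σ₂ 2) (arraysᴿ σ₂) 0<s enum₃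
      in P.printTree-correct σ₃ (neq , refl , Leq , Xeq) oeq then
      λ σ₄ (fr , oeq) → exec-map
        (λ oeq → record
          { A = arrays σ₃ 0 ; L = arrays σ₂ 2 ; X = arraysᴿ σ₂ ; xs≡ = xs≡ ; rad≡ = rad≡
          ; 0<s = 0<s ; enum = enum₃ ; compat = compat ; out≡ = oeq })
        (P.printLayers-correct σ₄ fr _ oeq)
      where
      f = suc ⌊log₂ n ⌋
      exec-map : ∀ {P σ b Q Q′} → (∀ {τ} → Q τ → Q′ τ) → Exec P σ b Q → Exec P σ b Q′
      exec-map h (exec r w q) = exec r w (h q)

    module Result {τ : State} (outcome : Output τ) where
      open Output outcome
      s = X 2 0 +ʳ X 2 0

      s≡ : s ≡ diameter D
      s≡ = cong (λ r → r 0 +ʳ r 0) rad≡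

      x≡ : ∀ v → X 0 (toℕ v) ≡ xs D v
      x≡ v = trans (cong (λ X → X (toℕ v)) xs≡) (pad-toℕ 0ʳ (proj₁ ∘ center D) v)

      y≡ : ∀ v → X₀ 1 (toℕ v) ≡ ys D v
      y≡ v = pad-toℕ 0ʳ (proj₂ ∘ center D) v

      short : ∀ u v → Adj G u v → X 0 (toℕ u) ≤ʳ X 0 (toℕ v) +ʳ s
      short u v adj rewrite x≡ u | x≡ v | s≡ = adjacent⇒near-x D u v adj

      open PathDecomposition R (X 0) s 0<s n A enum G short public

      layers-close : ∀ u v → Adj G u v → L (toℕ u) ≤ suc (L (toℕ v))
      layers-close u v adj = ≮⇒≥ λ far → ≤ʳ⇒≯ (adjacent⇒near-y D u v adj)
        (subst₂ (λ a b → b +ʳ diameter D <ʳ a) (y≡ u) (y≡ v) (proj₂ (compat (toℕ u) (toℕ v) (toℕ<n u) (toℕ<n v)) far))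

      layering : Layering G
      layering = record
        { layer = λ v → L (toℕ v)
        ; consecutive = λ u v adj → ∣-∣≤1 _ _ (layers-close u v adj) (layers-close v u (symmetric G adj)) }

      near-x : ∀ t u v → u ∈ bag decomposition t → v ∈ bag decomposition t → xs D u ≤ʳ xs D v +ʳ diameter D
      near-x t u v u∈ v∈ = subst (xs D u ≤ʳ_) (cong₂ _+ʳ_ (x≡ v) s≡) (subst (_≤ʳ X 0 (toℕ v) +ʳ s) (x≡ u)
        (bag-near (toℕ t) u v (≤-pred (toℕ<n t)) (inBag u∈) (inBag v∈)))

      near-y : ∀ u v → layer layering u ≡ layer layering v → ys D u ≤ʳ ys D v +ʳ diameter D
      near-y u v eq = subst₂ (λ a b → a ≤ʳ b +ʳ diameter D) (y≡ u) (y≡ v) (proj₁ (compat (toℕ u) (toℕ v) (toℕ<n u) (toℕ<n v)) eq)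

      computes : ∀ {k b} → Run program (input D) τ k → k ≤ b → ComputesWithin R D program b decomposition layering
      computes run within = description , _ , _ , run , within , trans out≡ (sym (serialized layering L (λ _ → refl)))

      open Independence R D public

    solution : ∀ {b} → Exec program (input D) b Output →
      Σ (TreeDecomposition G) λ 𝒯 → Σ (Layering G) λ ℒ →
        ComputesWithin R D program b 𝒯 ℒ × size 𝒯 ≤ suc n × (∀ t i → α≤ (bagLayer 𝒯 ℒ t i) 3)
    solution (exec run within outcome) =
      decomposition , layering , computes run within , ≤-refl , independenceNumber decomposition layering near-x near-y
      where open Result outcome

    bound : ∀ {b} → Exec program (input D) b Output → ∃[ k ] (IsLayeredTreeIndependenceNumber G k × k ≤ 3)
    bound (exec _ _ outcome) = layeredNumber decomposition layering near-x near-y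
      where open Result outcome

theorem4p11 : (R : Reals) → let open UnitDisks R in
    (∃[ P ] ∃[ time ] ∃[ nodes ]
    ( time ∈O (λ n → n * ⌊log₂ n ⌋)
    × nodes ∈O (λ n → n)
    × (∀ n (D : Family n) → let G = intersectionGraph D in
    Σ (TreeDecomposition G) λ 𝒯 → Σ (Layering G) λ L →
    ( ComputesWithin R D P (time n) 𝒯 L
    × size 𝒯 ≤ nodes n
    × (∀ (t : Fin (size 𝒯)) (i : ℕ) → α≤ (bagLayer 𝒯 L t i) 3)))))
    × (∀ n (D : Family n) → let G = intersectionGraph D in
    ∃[ k ] (IsLayeredTreeIndependenceNumber G k × k ≤ 3))
theorem4p11 R =
  -- The pair `2 , 1` witnesses n + 1 ≤ 2n for n ≥ 1.
  ( program , time , suc , time∈O , (2 , 1 , λ n 1≤n → +-mono-≤ 1≤n (m≤m+n n 0))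
  , λ n D → solution D (program-correct D) )
  , λ n D → bound D (program-correct D)
  where open Algorithm R
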